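{- Let $u,v\in\mathfrak S_n$. A flag positroid pipe dream $\mathrm{FPP}(u,v)$ (of $u$ with exit permutation $v$) exists if and only if $u\le v$ in Bruhat order. Moreover, the length $\ell(v)-\ell(u)$ of the interval $[u,v]$ equals the number of elbow tiles (not counting pivot elbows) in $\mathrm{FPP}(u,v)$.
   Context: Permutations $u=u_1\cdots u_n\in\mathfrak S_n$ are in one-line notation; $\ell$ is Coxeter length and $\le$ is Bruhat order. Use an $n\times n$ array, box $(i,j)$ in row $i$ from the top, column $j$ from the left. Tiles: empty; horizontal pipe (joins midpoints of left and right edges); vertical pipe (joins midpoints of top and bottom edges); pivot elbow (one arc joining top-edge midpoint to right-edge midpoint); cross (a horizontal and a vertical pipe); elbow (two arcs: top-edge midpoint to right-edge midpoint, and left-edge midpoint to bottom-edge midpoint). A Rothe pipe dream of $u$ is a tiling with: (i) $n$ pipes, each starting at the top edge and ending at the right edge; (ii) $(i,u_i)$ is a pivot elbow for each $i$; (iii) boxes $(i,j)$ with $u^{ -1}(j)<i$, $j<u_i$ are empty; (iv) boxes $(i,j)$ with $u^{ -1}(j)<i$, $j>u_i$ are horizontal pipes; (v) boxes $(i,j)$ with $u^{ -1}(j)>i$, $j<u_i$ are vertical pipes (so boxes with $u^{ -1}(j)>i$, $j>u_i$ are crosses or elbows). It is reduced if no two pipes cross (share a cross tile) more than once. The pipe starting at the top of column $j$ is labelled $j$; the exit permutation $v$ of a reduced Rothe pipe dream has $v_i$ = label of the pipe leaving the right edge in row $i$. Two pipes touch if they pass through a common elbow tile. A flag positroid pipe dream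 $\mathrm{FPP}(u,v)$ is a reduced Rothe pipe dream of $u$ with exit permutation $v$ such that whenever two pipes cross, they do not touch in any box southeast of their crossing. -}

module Defs where

open import Data.Nat using (ℕ; zero; suc; _+_; _*_; _<ᵇ_; _≡ᵇ_)
import Data.Nat as ℕ
open import Data.Bool using (Bool; true; false; if_then_else_; _∧_)
open import Data.Fin using (Fin; toℕ) renaming (_<_ to _<ᶠ_)
open import Data.Fin.Permutation using (Permutation′; _⟨$⟩ʳ_; _⟨$⟩ˡ_; transpose)
open import Data.List using (List; []; _∷_; map; allFin; length; filter)
open import Data.Nat.ListAction using (sum)
open import Data.List.Membership.Propositional using (_∈_)
open import Data.Product using (Σ; _×_; _,_)
open import Data.Sum using (_⊎_)
open import Relation.Binary.PropositionalEquality using (_≡_)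
open import Relation.Nullary using (¬_)

ℓ : ∀ {n} → Permutation′ n → ℕ
ℓ {n} u = sum (map (λ i → sum (map (λ j → inv i j) (allFin n))) (allFin n))
  where
  inv : Fin n → Fin n → ℕ
  inv i j = if (toℕ i <ᵇ toℕ j) ∧ (toℕ (u ⟨$⟩ʳ j) <ᵇ toℕ (u ⟨$⟩ʳ i)) then 1 else 0

BruhatStep : ∀ {n} → Permutation′ n → Permutation′ n → Set
BruhatStep {n} u w =
  Σ (Fin n) λ i → Σ (Fin n) λ j → ¬ (i ≡ j) ×
    ((∀ k → w ⟨$⟩ʳ k ≡ u ⟨$⟩ʳ (transpose i j ⟨$⟩ʳ k)) × (ℓ u ℕ.< ℓ w))

data _≤B_ {n : ℕ} : Permutation′ n → Permutation′ n → Set where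
  ≤B-refl : ∀ {u v} → (∀ k → u ⟨$⟩ʳ k ≡ v ⟨$⟩ʳ k) → u ≤B v
  ≤B-step : ∀ {u w v} → BruhatStep u w → w ≤B v → u ≤B v

data Tile : Set where
  empty hor vert pivot cross elbow : Tile

-- box (i , j): row i from the top, column j from the left (0-based)
Tiling : ℕ → Set
Tiling n = Fin n → Fin n → Tile

IsRothe : ∀ {n} → Permutation′ n → Tiling n → Set
IsRothe {n} u D =
  (∀ (i : Fin n) → D i (u ⟨$⟩ʳ i) ≡ pivot) ×
  (∀ (i j : Fin n) → (u ⟨$⟩ˡ j) <ᶠ i → j <ᶠ (u ⟨$⟩ʳ i) → D i j ≡ empty) ×
  (∀ (i j : Fin n) → (u ⟨$⟩ˡ j) <ᶠ i → (u ⟨$⟩ʳ i) <ᶠ j → D i j ≡ hor) ×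
  (∀ (i j : Fin n) → i <ᶠ (u ⟨$⟩ˡ j) → j <ᶠ (u ⟨$⟩ʳ i) → D i j ≡ vert) ×
  (∀ (i j : Fin n) → i <ᶠ (u ⟨$⟩ˡ j) → (u ⟨$⟩ʳ i) <ᶠ j →
     (D i j ≡ cross) ⊎ (D i j ≡ elbow))

data Entry : Set where
  fromTop fromLeft : Entry

data Outcome : Set where
  exitRight : ℕ → Outcome
  broken    : Outcome       -- leaves through the bottom, dead-ends, or runs out of fuel

toFin? : (n : ℕ) → ℕ → Fin n ⊎ Bool
toFin? zero    _       = Data.Sum.inj₂ false
toFin? (suc n) zero    = Data.Sum.inj₁ Fin.zero
toFin? (suc n) (suc i) with toFin? n i
... | Data.Sum.inj₁ k = Data.Sum.inj₁ (Fin.suc k)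
... | Data.Sum.inj₂ b = Data.Sum.inj₂ b

follow : ∀ {n} → Tiling n → ℕ → ℕ → ℕ → Entry → List (ℕ × ℕ) × Outcome
follow {n} D fuel i j e with toFin? n i | toFin? n j
... | Data.Sum.inj₂ _ | _ = [] , broken
... | Data.Sum.inj₁ _ | Data.Sum.inj₂ _ = [] , exitRight i
... | Data.Sum.inj₁ fi | Data.Sum.inj₁ fj = go fuel (D fi fj) e
  where
  cons : List (ℕ × ℕ) × Outcome → List (ℕ × ℕ) × Outcome
  cons (bs , o) = ((i , j) ∷ bs) , o
  go : ℕ → Tile → Entry → List (ℕ × ℕ) × Outcome
  go zero     _     _        = [] , broken
  go (suc f) vert  fromTop  = cons (follow D f (suc i) j fromTop)
  go (suc f) cross fromTop  = cons (follow D f (suc i) j fromTop)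
  go (suc f) pivot fromTop  = cons (follow D f i (suc j) fromLeft)
  go (suc f) elbow fromTop  = cons (follow D f i (suc j) fromLeft)
  go (suc f) hor   fromLeft = cons (follow D f i (suc j) fromLeft)
  go (suc f) cross fromLeft = cons (follow D f i (suc j) fromLeft)
  go (suc f) elbow fromLeft = cons (follow D f (suc i) j fromTop)
  go (suc f) _     _        = [] , broken

-- The pipe labelled j starts at the top edge of column j.
-- Fuel 2n suffices: each step increases row+column by one.
pipe : ∀ {n} → Tiling n → Fin n → List (ℕ × ℕ) × Outcome
pipe {n} D j = follow D (2 * n) 0 (toℕ j) fromTop

boxesOf : ∀ {n} → Tiling n → Fin n → List (ℕ × ℕ)
boxesOf D j = Data.Product.proj₁ (pipe D j)

exitOf : ∀ {n} → Tiling n → Fin n → Outcome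
exitOf D j = Data.Product.proj₂ (pipe D j)

tileAt : ∀ {n} → Tiling n → ℕ × ℕ → Tile
tileAt {n} D (i , j) with toFin? n i | toFin? n j
... | Data.Sum.inj₁ fi | Data.Sum.inj₁ fj = D fi fj
... | _ | _ = empty

CrossAt : ∀ {n} → Tiling n → Fin n → Fin n → ℕ × ℕ → Set
CrossAt D p q b = tileAt D b ≡ cross × (b ∈ boxesOf D p) × (b ∈ boxesOf D q)

TouchAt : ∀ {n} → Tiling n → Fin n → Fin n → ℕ × ℕ → Set
TouchAt D p q b = tileAt D b ≡ elbow × (b ∈ boxesOf D p) × (b ∈ boxesOf D q)

AllPipesExitRight : ∀ {n} → Tiling n → Set
AllPipesExitRight {n} D = ∀ (j : Fin n) → Σ ℕ λ r → exitOf D j ≡ exitRight r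

IsReduced : ∀ {n} → Tiling n → Set
IsReduced {n} D = ∀ (p q : Fin n) → ¬ (p ≡ q) → ∀ b c →
  CrossAt D p q b → CrossAt D p q c → b ≡ c

HasExitPerm : ∀ {n} → Tiling n → Permutation′ n → Set
HasExitPerm {n} D v = ∀ (i : Fin n) → exitOf D (v ⟨$⟩ʳ i) ≡ exitRight (toℕ i)

NoTouchAfterCross : ∀ {n} → Tiling n → Set
NoTouchAfterCross {n} D = ∀ (p q : Fin n) → ¬ (p ≡ q) → ∀ a b c d →
  CrossAt D p q (a , b) → a ℕ.< c → b ℕ.< d → ¬ TouchAt D p q (c , d)

IsFPP : ∀ {n} → Permutation′ n → Permutation′ n → Tiling n → Set
IsFPP u v D =
  IsRothe u D × AllPipesExitRight D × IsReduced D × HasExitPerm D v ×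
  NoTouchAfterCross D

elbowCount : ∀ {n} → Tiling n → ℕ
elbowCount {n} D =
  sum (map (λ i → length (filter (λ j → isElbow (D i j)) (allFin n))) (allFin n))
  where
  open import Relation.Nullary.Decidable using (yes; no)
  open import Relation.Unary using (Decidable)
  isElbow : Decidable (_≡ elbow)
  isElbow elbow = yes Relation.Binary.PropositionalEquality.refl
  isElbow empty = no λ ()
  isElbow hor   = no λ ()
  isElbow vert  = no λ ()
  isElbow pivot = no λ ()
  isElbow cross = no λ ()

{-# OPTIONS --safe #-}
module Submission where

-- Read the boxes row by row and let W be the permutation sending a row m to the label of the pipe
-- that would leave in row m if all unread boxes were crosses: W starts at u, a cross leaves it
-- alone, and an elbow (i , j) multiplies it by the transposition of the rows i and u⁻¹ j, so that W
-- ends at the exit permutation v.  Call the tiling ascending if at every cross and every elbow the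
-- pipe entering from the left has a smaller label than the pipe entering from the top.  Two pipes
-- are out of order on the frontier between read and unread boxes exactly when they have crossed,
-- and therefore a Rothe pipe dream is an FPP if and only if it is ascending.  Then every elbow is a
-- Bruhat step up for W, whence u ≤ v.  The pairs of rows whose labels increase along the frontier
-- number ℓ v for W, and ℓ u for u, once everything is read; a cross removes one such pair for both
-- W and u, an elbow one for u only, which gives the number of elbows.
-- Conversely, start from W = v at the end and read backwards, sorting the two labels at each
-- box: a cross if they are out of order after the box, an elbow otherwise.  Sorting preserves
-- the rank inequalities expressing u ≤ v, and at the beginning these leave only W = u.

open import Defs
open import Data.Nat using (ℕ; zero; suc; _+_; _*_; _∸_; _≤_; _<_; z≤n; s≤s; _<ᵇ_)
open import Data.Nat.Properties
open import Algebra.Properties.CommutativeSemigroup +-commutativeSemigroup using (interchange)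
open import Data.Nat.Induction using (<-rec)
open import Data.Bool using (Bool; true; false; if_then_else_; _∧_)
open import Data.Fin using (Fin; zero; suc; toℕ; fromℕ<) renaming (_<_ to _<ᶠ_)
import Data.Fin.Properties as Fin
open import Data.Fin.Permutation using (Permutation′; _⟨$⟩ʳ_; _⟨$⟩ˡ_; transpose; _∘ₚ_; inverseˡ; inverseʳ)
open import Data.List using (List; []; _∷_; _++_; map; allFin; length; filter)
open import Data.List.Properties using (map-tabulate; ++-assoc; ++-identityʳ)
open import Data.List.Membership.Propositional using (_∈_)
open import Data.List.Membership.Propositional.Properties using (∈-++⁻; ∈-++⁺ʳ)
open import Data.List.Relation.Unary.Any using (here)
open import Data.Nat.ListAction using (sum)
open import Data.Product.Properties using (,-injective)
open import Data.Product using (Σ; _×_; _,_; proj₁; proj₂)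
open import Data.Sum using (_⊎_; inj₁; inj₂; [_,_])
open import Function.Base using (_∘_; id)
open import Function.Bundles using (_⇔_; mk⇔)
open import Relation.Binary.Definitions using (Tri; tri<; tri≈; tri>)
open import Relation.Binary.PropositionalEquality using (_≡_; _≢_; refl; sym; trans; cong; cong₂; subst; subst₂; module ≡-Reasoning)
open import Relation.Nullary using (Dec; ¬_; yes; no; contradiction)

private
  variable
    n : ℕ

-- Indicators of Boolean comparisons

𝟙 : Bool → ℕ
𝟙 b = if b then 1 else 0

<ᵇ-true : ∀ {m o} → m < o → (m <ᵇ o) ≡ true
<ᵇ-true {zero}  {suc o} _         = refl
<ᵇ-true {suc m} {suc o} (s≤s m<o) = <ᵇ-true m<o

<ᵇ-true⁻¹ : ∀ m o → (m <ᵇ o) ≡ true → m < o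
<ᵇ-true⁻¹ zero    (suc o) _ = s≤s z≤n
<ᵇ-true⁻¹ (suc m) (suc o) e = s≤s (<ᵇ-true⁻¹ m o e)

<ᵇ-false : ∀ {m o} → ¬ m < o → (m <ᵇ o) ≡ false
<ᵇ-false {m} {o} m≮o with m <ᵇ o in e
... | true  = contradiction (<ᵇ-true⁻¹ m o e) m≮o
... | false = refl

Bool-ext : ∀ {a b} → (a ≡ true → b ≡ true) → (b ≡ true → a ≡ true) → a ≡ b
Bool-ext {true}  {b}     f _ = sym (f refl)
Bool-ext {false} {true}  _ g = g refl
Bool-ext {false} {false} _ _ = refl

<ᵇ-cong : ∀ {m o p q} → (m < o → p < q) → (p < q → m < o) → (m <ᵇ o) ≡ (p <ᵇ q)
<ᵇ-cong {m} {o} {p} {q} f g =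
  Bool-ext (<ᵇ-true ∘ f ∘ <ᵇ-true⁻¹ m o) (<ᵇ-true ∘ g ∘ <ᵇ-true⁻¹ p q)

<ᵇ-mono : ∀ {m o p q} → (m < o → p < q) → (m <ᵇ o) ≡ true → (p <ᵇ q) ≡ true
<ᵇ-mono {m} {o} f = <ᵇ-true ∘ f ∘ <ᵇ-true⁻¹ m o

𝟙-mono : ∀ {a b} → (a ≡ true → b ≡ true) → 𝟙 a ≤ 𝟙 b
𝟙-mono {false} _ = z≤n
𝟙-mono {true}  f rewrite f refl = ≤-refl

𝟙≤1 : ∀ a → 𝟙 a ≤ 1
𝟙≤1 true  = ≤-refl
𝟙≤1 false = z≤n

-- The rearrangement inequality for truth values. In each use one factor speaks of rows and the
-- other of labels.
rearrangement : ∀ {a a′ b b′} → (a ≡ true → a′ ≡ true) → (b ≡ true → b′ ≡ true) →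
                𝟙 (a ∧ b′) + 𝟙 (a′ ∧ b) ≤ 𝟙 (a ∧ b) + 𝟙 (a′ ∧ b′)
rearrangement {false} {false} _ _ = z≤n
rearrangement {false} {true}  _ g = 𝟙-mono g
rearrangement {true} {b = b} {b′} f _ rewrite f refl = ≤-reflexive (+-comm (𝟙 b′) (𝟙 b))

-- Finite sums

∑ : (Fin n → ℕ) → ℕ
∑ {n} f = sum (map f (allFin n))

∑-suc : (f : Fin (suc n) → ℕ) → ∑ f ≡ f zero + ∑ (f ∘ suc)
∑-suc f = cong (λ xs → f zero + sum xs) (trans (map-tabulate suc f) (sym (map-tabulate id (f ∘ suc))))

∑-mono : {f g : Fin n → ℕ} → (∀ m → f m ≤ g m) → ∑ f ≤ ∑ g
∑-mono {zero}  _ = z≤n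
∑-mono {suc n} {f} {g} h rewrite ∑-suc f | ∑-suc g = +-mono-≤ (h zero) (∑-mono (h ∘ suc))

∑-cong : {f g : Fin n → ℕ} → (∀ m → f m ≡ g m) → ∑ f ≡ ∑ g
∑-cong h = ≤-antisym (∑-mono (≤-reflexive ∘ h)) (∑-mono (≤-reflexive ∘ sym ∘ h))

∑-+ : (f g : Fin n → ℕ) → ∑ (λ m → f m + g m) ≡ ∑ f + ∑ g
∑-+ {zero}  f g = refl
∑-+ {suc n} f g rewrite ∑-suc f | ∑-suc g | ∑-suc (λ m → f m + g m) | ∑-+ (f ∘ suc) (g ∘ suc) =
  interchange (f zero) (g zero) (∑ (f ∘ suc)) (∑ (g ∘ suc))

-- This is `∑ f - f i ≤ ∑ g - g i`, with the subtracted terms carried to the other sides because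
-- subtraction on `ℕ` truncates.
∑-single-≤ : {f g : Fin n → ℕ} (i : Fin n) → (∀ m → m ≢ i → f m ≤ g m) → ∑ f + g i ≤ ∑ g + f i
∑-single-≤ {suc n} {f} {g} zero h rewrite ∑-suc f | ∑-suc g = begin
  f zero + ∑ (f ∘ suc) + g zero    ≡⟨ cong (_+ g zero) (+-comm (f zero) _) ⟩
  ∑ (f ∘ suc) + f zero + g zero    ≡⟨ +-assoc (∑ (f ∘ suc)) _ _ ⟩
  ∑ (f ∘ suc) + (f zero + g zero)  ≤⟨ +-mono-≤ (∑-mono (λ m → h (suc m) λ ())) (≤-reflexive (+-comm (f zero) _)) ⟩
  ∑ (g ∘ suc) + (g zero + f zero)  ≡⟨ sym (+-assoc (∑ (g ∘ suc)) _ _) ⟩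
  ∑ (g ∘ suc) + g zero + f zero    ≡⟨ cong (_+ f zero) (+-comm _ (g zero)) ⟩
  g zero + ∑ (g ∘ suc) + f zero    ∎
  where open ≤-Reasoning
∑-single-≤ {suc n} {f} {g} (suc i) h rewrite ∑-suc f | ∑-suc g = begin
  f zero + ∑ (f ∘ suc) + g (suc i)    ≡⟨ +-assoc (f zero) _ _ ⟩
  f zero + (∑ (f ∘ suc) + g (suc i))  ≤⟨ +-mono-≤ (h zero λ ()) (∑-single-≤ i (λ m m≢i → h (suc m) (m≢i ∘ Fin.suc-injective))) ⟩
  g zero + (∑ (g ∘ suc) + f (suc i))  ≡⟨ sym (+-assoc (g zero) _ _) ⟩
  g zero + ∑ (g ∘ suc) + f (suc i)    ∎
  where open ≤-Reasoning

∑-single : {f g : Fin n → ℕ} (i : Fin n) → (∀ m → m ≢ i → f m ≡ g m) → ∑ f + g i ≡ ∑ g + f i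
∑-single i h = ≤-antisym (∑-single-≤ i (λ m → ≤-reflexive ∘ h m)) (∑-single-≤ i (λ m → ≤-reflexive ∘ sym ∘ h m))

∑-squeeze : {f g : Fin n → ℕ} → (∀ m → f m ≤ g m) → ∑ g ≤ ∑ f → ∀ i → g i ≤ f i
∑-squeeze {f = f} {g} h ∑g≤∑f i =
  +-cancelˡ-≤ (∑ g) _ _ (≤-trans (+-monoˡ-≤ (g i) ∑g≤∑f) (∑-single-≤ i (λ m _ → h m)))

∑-pair-≤ : {f g : Fin n → ℕ} {i k : Fin n} → i ≢ k → (∀ m → m ≢ i → m ≢ k → f m ≤ g m) →
           ∑ f + (g i + g k) ≤ ∑ g + (f i + f k)
∑-pair-≤ {n} {f} {g} {i} {k} i≢k h = begin
  ∑ f + (g i + g k)    ≡⟨ cong (∑ f +_) (+-comm (g i) _) ⟩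
  ∑ f + (g k + g i)    ≡⟨ sym (+-assoc (∑ f) _ _) ⟩
  ∑ f + g k + g i      ≤⟨ +-monoˡ-≤ (g i) (subst (λ z → ∑ f + z ≤ ∑ f′ + f k) f′k (∑-single-≤ k (λ m m≢k → ≤-reflexive (sym (f′off m m≢k))))) ⟩
  ∑ f′ + f k + g i     ≡⟨ trans (+-assoc (∑ f′) _ _) (trans (cong (∑ f′ +_) (+-comm (f k) _)) (sym (+-assoc (∑ f′) _ _))) ⟩
  ∑ f′ + g i + f k     ≤⟨ +-monoˡ-≤ (f k) (subst (λ z → ∑ f′ + g i ≤ ∑ g + z) (f′off i i≢k) (∑-single-≤ i f′≤g)) ⟩
  ∑ g + f i + f k      ≡⟨ +-assoc (∑ g) _ _ ⟩
  ∑ g + (f i + f k)    ∎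
  where
  open ≤-Reasoning
  f′ : Fin n → ℕ
  f′ m with m Fin.≟ k
  ... | yes _ = g k
  ... | no  _ = f m
  f′k : f′ k ≡ g k
  f′k with k Fin.≟ k
  ... | yes _ = refl
  ... | no k≢k = contradiction refl k≢k
  f′off : ∀ m → m ≢ k → f′ m ≡ f m
  f′off m m≢k with m Fin.≟ k
  ... | yes m≡k = contradiction m≡k m≢k
  ... | no _ = refl
  f′≤g : ∀ m → m ≢ i → f′ m ≤ g m
  f′≤g m m≢i with m Fin.≟ k
  ... | yes refl = ≤-refl
  ... | no m≢k = h m m≢i m≢k

module _ {f g : Fin n → ℕ} {i k : Fin n} (i≢k : i ≢ k) where

  ∑-pair-mono : (∀ m → m ≢ i → m ≢ k → f m ≤ g m) → f i + f k ≤ g i + g k → ∑ f ≤ ∑ g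
  ∑-pair-mono h p = +-cancelʳ-≤ (g i + g k) _ _ (≤-trans (∑-pair-≤ i≢k h) (+-monoʳ-≤ (∑ g) p))

  ∑-pair-mono-< : (∀ m → m ≢ i → m ≢ k → f m ≤ g m) → f i + f k < g i + g k → ∑ f < ∑ g
  ∑-pair-mono-< h p = +-cancelʳ-< (g i + g k) _ _ (≤-<-trans (∑-pair-≤ i≢k h) (+-monoʳ-< (∑ g) p))

∑-pair-cong : {f g : Fin n → ℕ} {i k : Fin n} → i ≢ k → (∀ m → m ≢ i → m ≢ k → f m ≡ g m) →
              f i + f k ≡ g i + g k → ∑ f ≡ ∑ g
∑-pair-cong i≢k h p = ≤-antisym
  (∑-pair-mono i≢k (λ m m≢i m≢k → ≤-reflexive (h m m≢i m≢k)) (≤-reflexive p))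
  (∑-pair-mono i≢k (λ m m≢i m≢k → ≤-reflexive (sym (h m m≢i m≢k))) (≤-reflexive (sym p)))

∑-telescope : (f : Fin n → ℕ) (g : ℕ → ℕ) → (∀ j → g (suc (toℕ j)) ≡ g (toℕ j) + f j) →
              g n ≡ g 0 + ∑ f
∑-telescope {zero}  f g h = sym (+-identityʳ (g 0))
∑-telescope {suc n} f g h = begin
  g (suc n)                      ≡⟨ ∑-telescope (f ∘ suc) (g ∘ suc) (h ∘ suc) ⟩
  g 1 + ∑ (f ∘ suc)              ≡⟨ cong (_+ ∑ (f ∘ suc)) (h zero) ⟩
  g 0 + f zero + ∑ (f ∘ suc)     ≡⟨ +-assoc (g 0) _ _ ⟩
  g 0 + (f zero + ∑ (f ∘ suc))   ≡⟨ cong (g 0 +_) (sym (∑-suc f)) ⟩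
  g 0 + ∑ f                      ∎
  where open ≡-Reasoning

-- Transpositions and the Bruhat order

among : (i k m : Fin n) → (m ≡ i ⊎ m ≡ k) ⊎ (m ≢ i × m ≢ k)
among i k m with m Fin.≟ i | m Fin.≟ k
... | yes m≡i | _       = inj₁ (inj₁ m≡i)
... | no _    | yes m≡k = inj₁ (inj₂ m≡k)
... | no m≢i  | no m≢k  = inj₂ (m≢i , m≢k)

transpose-left : (i k : Fin n) → transpose i k ⟨$⟩ʳ i ≡ k
transpose-left i k with i Fin.≟ i
... | yes _ = refl
... | no i≢i = contradiction refl i≢i

transpose-right : (i k : Fin n) → transpose i k ⟨$⟩ʳ k ≡ i
transpose-right i k with k Fin.≟ i
... | yes k≡i = k≡i
... | no _ with k Fin.≟ k
...   | yes _ = refl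
...   | no k≢k = contradiction refl k≢k

transpose-other : {i k m : Fin n} → m ≢ i → m ≢ k → transpose i k ⟨$⟩ʳ m ≡ m
transpose-other {i = i} {k} {m} m≢i m≢k with m Fin.≟ i
... | yes m≡i = contradiction m≡i m≢i
... | no _ with m Fin.≟ k
...   | yes m≡k = contradiction m≡k m≢k
...   | no _ = refl

⟨$⟩ʳ-injective : (w : Permutation′ n) {a b : Fin n} → w ⟨$⟩ʳ a ≡ w ⟨$⟩ʳ b → a ≡ b
⟨$⟩ʳ-injective w e = trans (sym (inverseˡ w)) (trans (cong (w ⟨$⟩ˡ_) e) (inverseˡ w))

⟦_⟧ : Permutation′ n → Fin n → ℕ
⟦ w ⟧ m = toℕ (w ⟨$⟩ʳ m)

⟦⟧-injective : (w : Permutation′ n) {a b : Fin n} → ⟦ w ⟧ a ≡ ⟦ w ⟧ b → a ≡ b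
⟦⟧-injective w = ⟨$⟩ʳ-injective w ∘ Fin.toℕ-injective

Inv : (f : Fin n → ℕ) → Fin n → Fin n → ℕ
Inv f m m′ = 𝟙 ((toℕ m <ᵇ toℕ m′) ∧ (f m′ <ᵇ f m))

-- The matrix `Inv` is compared by blocks. `rearrangement` handles the columns `i` and `k` in any
-- other row, and the rows `i` and `k` in any other column. In the remaining two by two block the
-- pair `(i , k)` becomes an inversion, whence strictness.
Inv-swap-< : {f g : Fin n → ℕ} {i k : Fin n} → toℕ i < toℕ k → f i < f k →
             g i ≡ f k → g k ≡ f i → (∀ m → m ≢ i → m ≢ k → g m ≡ f m) →
             ∑ (λ m → ∑ (Inv f m)) < ∑ (λ m → ∑ (Inv g m))
Inv-swap-< {n} {f} {g} {i} {k} i<k fi<fk gi gk goff = ∑-pair-mono-< i≢k rows pair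
  where
  i≢k : i ≢ k
  i≢k refl = <-irrefl refl i<k
  rows : ∀ m → m ≢ i → m ≢ k → ∑ (Inv f m) ≤ ∑ (Inv g m)
  rows m m≢i m≢k = ∑-pair-mono i≢k off both
    where
    off : ∀ m′ → m′ ≢ i → m′ ≢ k → Inv f m m′ ≤ Inv g m m′
    off m′ m′≢i m′≢k rewrite goff m m≢i m≢k | goff m′ m′≢i m′≢k = ≤-refl
    both : Inv f m i + Inv f m k ≤ Inv g m i + Inv g m k
    both rewrite goff m m≢i m≢k | gi | gk =
      rearrangement (<ᵇ-mono {toℕ m} (λ m<i → <-trans m<i i<k)) (<ᵇ-mono {f k} {f m} (<-trans fi<fk))
  off : ∀ m′ → m′ ≢ i → m′ ≢ k → Inv f i m′ + Inv f k m′ ≤ Inv g i m′ + Inv g k m′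
  off m′ m′≢i m′≢k rewrite goff m′ m′≢i m′≢k | gi | gk =
    subst₂ _≤_ (+-comm (Inv f k m′) _) (+-comm (𝟙 ((toℕ k <ᵇ toℕ m′) ∧ (f m′ <ᵇ f i))) _)
      (rearrangement (<ᵇ-mono {toℕ k} {toℕ m′} (<-trans i<k)) (<ᵇ-mono (λ m′<i → <-trans m′<i fi<fk)))
  corner : (Inv f i i + Inv f k i) + (Inv f i k + Inv f k k) < (Inv g i i + Inv g k i) + (Inv g i k + Inv g k k)
  corner rewrite <ᵇ-false (<-irrefl {toℕ i} refl) | <ᵇ-false (<-irrefl {toℕ k} refl)
               | <ᵇ-false (<-asym i<k) | <ᵇ-true i<k | gi | gk
               | <ᵇ-false (<-asym fi<fk) | <ᵇ-true fi<fk = s≤s z≤n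
  pair : ∑ (Inv f i) + ∑ (Inv f k) < ∑ (Inv g i) + ∑ (Inv g k)
  pair = subst₂ _<_ (∑-+ (Inv f i) (Inv f k)) (∑-+ (Inv g i) (Inv g k)) (∑-pair-mono-< i≢k off corner)

ℓ-cong : {u v : Permutation′ n} → (∀ k → u ⟨$⟩ʳ k ≡ v ⟨$⟩ʳ k) → ℓ u ≡ ℓ v
ℓ-cong {n} {u} {v} e = ∑-cong {n} {λ m → ∑ (Inv ⟦ u ⟧ m)} {λ m → ∑ (Inv ⟦ v ⟧ m)} λ m → ∑-cong λ m′ →
  cong₂ (λ a b → 𝟙 ((toℕ m <ᵇ toℕ m′) ∧ (toℕ a <ᵇ toℕ b))) (e m′) (e m)

ℓ-transpose-< : (w : Permutation′ n) {i k : Fin n} → i <ᶠ k → ⟦ w ⟧ i < ⟦ w ⟧ k → ℓ w < ℓ (transpose i k ∘ₚ w)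
ℓ-transpose-< w {i} {k} i<k wi<wk = Inv-swap-< {f = ⟦ w ⟧} {⟦ transpose i k ∘ₚ w ⟧} i<k wi<wk
  (cong ⟦ w ⟧ (transpose-left i k)) (cong ⟦ w ⟧ (transpose-right i k))
  (λ m m≢i m≢k → cong ⟦ w ⟧ (transpose-other m≢i m≢k))

BruhatStep-transpose : (w : Permutation′ n) {i k : Fin n} → i <ᶠ k → ⟦ w ⟧ i < ⟦ w ⟧ k →
                       BruhatStep w (transpose i k ∘ₚ w)
BruhatStep-transpose w {i} {k} i<k wi<wk =
  i , k , (λ i≡k → <-irrefl (cong toℕ i≡k) i<k) , (λ _ → refl) , ℓ-transpose-< w i<k wi<wk

≤B-respʳ : {u v w : Permutation′ n} → u ≤B v → (∀ k → v ⟨$⟩ʳ k ≡ w ⟨$⟩ʳ k) → u ≤B w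
≤B-respʳ (≤B-refl e)   e′ = ≤B-refl (λ k → trans (e k) (e′ k))
≤B-respʳ (≤B-step s c) e′ = ≤B-step s (≤B-respʳ c e′)

-- `≤B-step` puts a step at the lower end of a chain, while the sweep starts from `u` and has to
-- append its steps at the upper end.
≤B-snoc : {u v w : Permutation′ n} → u ≤B v → BruhatStep v w → u ≤B w
≤B-snoc {u = u} {v} {w} (≤B-refl e) (i , j , i≢j , h , lt) =
  ≤B-step {w = w} (i , j , i≢j , (λ k → trans (h k) (sym (e _))) , subst (_< ℓ w) (sym (ℓ-cong {u = u} {v} e)) lt) (≤B-refl (λ _ → refl))
≤B-snoc (≤B-step s c) s′ = ≤B-step s (≤B-snoc c s′)

-- Sweeping the array row by row

toFin?-toℕ : (i : Fin n) → toFin? n (toℕ i) ≡ inj₁ i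
toFin?-toℕ zero = refl
toFin?-toℕ (suc i) rewrite toFin?-toℕ i = refl

toFin?-n : ∀ n → Σ Bool λ b → toFin? n n ≡ inj₂ b
toFin?-n zero = false , refl
toFin?-n (suc n) with toFin? n n | toFin?-n n
... | _ | b , refl = b , refl

tileAt-toℕ : (D : Tiling n) (i j : Fin n) → tileAt D (toℕ i , toℕ j) ≡ D i j
tileAt-toℕ D i j rewrite toFin?-toℕ i | toFin?-toℕ j = refl

bounded-induction : (P : ℕ → Set) → P 0 → (∀ (i : Fin n) → P (toℕ i) → P (suc (toℕ i))) →
                    ∀ {i} → i ≤ n → P i
bounded-induction P z s {zero} _ = z
bounded-induction P z s {suc i} i<n =
  subst (P ∘ suc) (Fin.toℕ-fromℕ< i<n)
    (s (fromℕ< i<n) (subst P (sym (Fin.toℕ-fromℕ< i<n)) (bounded-induction P z s (<⇒≤ i<n))))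

module _ (P : ℕ → ℕ → Set)
         (base : P 0 0)
         (step : ∀ (i j : Fin n) → P (toℕ i) (toℕ j) → P (toℕ i) (suc (toℕ j)))
         (next : ∀ (i : Fin n) → P (toℕ i) n → P (suc (toℕ i)) 0) where

  sweep-row : (i : Fin n) → P (toℕ i) 0 → ∀ {j} → j ≤ n → P (toℕ i) j
  sweep-row i p = bounded-induction (P (toℕ i)) p (step i)

  -- The end `(i , n)` of a row and the start `(suc i , 0)` of the next are separate positions; the
  -- array has been read completely at `(n , 0)`.
  sweep-start : ∀ {i} → i ≤ n → P i 0
  sweep-start = bounded-induction (λ i → P i 0) base (λ i p → next i (sweep-row i p ≤-refl))

  sweep-box : (i : Fin n) → ∀ {j} → j ≤ n → P (toℕ i) j
  sweep-box i = sweep-row i (sweep-start (<⇒≤ (Fin.toℕ<n i)))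

module Sweep {A : Set} (step : Fin n → Fin n → A → A) (a : A) where

  stepℕ : ℕ → ℕ → A → A
  stepℕ i j x with toFin? n i | toFin? n j
  ... | inj₁ i | inj₁ j = step i j x
  ... | _      | _      = x

  before : ℕ → ℕ → A
  start  : ℕ → A
  before i zero    = start i
  before i (suc j) = stepℕ i j (before i j)
  start zero    = a
  start (suc i) = before i n

  before-step : (i j : Fin n) → before (toℕ i) (suc (toℕ j)) ≡ step i j (before (toℕ i) (toℕ j))
  before-step i j rewrite toFin?-toℕ i | toFin?-toℕ j = refl

-- One step of a pipe

data Moves : Tile → Entry → Entry → Set where
  vert-↓  : Moves vert fromTop fromTop
  pivot-→ : Moves pivot fromTop fromLeft
  hor-→   : Moves hor fromLeft fromLeft
  cross-↓ : Moves cross fromTop fromTop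
  cross-→ : Moves cross fromLeft fromLeft
  elbow-→ : Moves elbow fromTop fromLeft
  elbow-↓ : Moves elbow fromLeft fromTop

nextRow nextCol : ℕ → Entry → ℕ
nextRow i fromTop  = suc i
nextRow i fromLeft = i
nextCol j fromTop  = j
nextCol j fromLeft = suc j

next-sum : ∀ i j e → nextRow i e + nextCol j e ≡ suc (i + j)
next-sum i j fromTop  = refl
next-sum i j fromLeft = +-suc i j

prepend : List (ℕ × ℕ) → List (ℕ × ℕ) × Outcome → List (ℕ × ℕ) × Outcome
prepend xs (ys , o) = xs ++ ys , o

prepend-++ : ∀ xs ys r → prepend xs (prepend ys r) ≡ prepend (xs ++ ys) r
prepend-++ xs ys (zs , o) = cong (_, o) (sym (++-assoc xs ys zs))

-- `Moves` lists the clauses of `follow` in which a pipe gets on, so one equation unfolds all of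
-- them; the entry `e′` into the next box also determines where that box is.
follow-step : (D : Tiling n) (i j : Fin n) {e e′ : Entry} → Moves (D i j) e e′ → ∀ f →
              follow D (suc f) (toℕ i) (toℕ j) e ≡
              prepend ((toℕ i , toℕ j) ∷ []) (follow D f (nextRow (toℕ i) e′) (nextCol (toℕ j) e′) e′)
follow-step D i j mv f rewrite toFin?-toℕ i | toFin?-toℕ j with D i j | mv
... | _ | vert-↓  = refl
... | _ | pivot-→ = refl
... | _ | hor-→   = refl
... | _ | cross-↓ = refl
... | _ | cross-→ = refl
... | _ | elbow-→ = refl
... | _ | elbow-↓ = refl

follow-exit : (D : Tiling n) (i : Fin n) (f : ℕ) → follow D f (toℕ i) n fromLeft ≡ ([] , exitRight (toℕ i))
follow-exit {n} D i f rewrite toFin?-toℕ i with toFin? n n | toFin?-n n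
... | _ | _ , refl = refl

-- Orders given by integer keys

dbl : ℕ → ℕ
dbl zero    = zero
dbl (suc m) = suc (suc (dbl m))

dbl-mono : ∀ {m o} → m ≤ o → dbl m ≤ dbl o
dbl-mono z≤n     = z≤n
dbl-mono (s≤s h) = s≤s (s≤s (dbl-mono h))

Between Outside : ℕ → ℕ → ℕ → Set
Between α β x = α ≤ x × x ≤ β
Outside α β x = x < α ⊎ β < x

SameOrder : (κ κ′ : Fin n → ℕ) → Set
SameOrder κ κ′ = ∀ m m′ → (κ m < κ m′ → κ′ m < κ′ m′) × (κ′ m < κ′ m′ → κ m < κ m′)

SameOrder-cong : {κ κ′ : Fin n → ℕ} → (∀ m → κ m ≡ κ′ m) → SameOrder κ κ′
SameOrder-cong e m m′ = subst₂ _<_ (e m) (e m′) , subst₂ _<_ (sym (e m)) (sym (e m′))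

-- Only the elements of I change their keys, and they stay inside a window free of other keys.
Local : (α β : ℕ) (I : Fin n → Set) (κ κ′ : Fin n → ℕ) → Set
Local α β I κ κ′ = ∀ m → (I m × Between α β (κ m) × Between α β (κ′ m)) ⊎ (κ m ≡ κ′ m × Outside α β (κ m))

Local-sym : ∀ {α β} {I : Fin n → Set} {κ κ′} → Local α β I κ κ′ → Local α β I κ′ κ
Local-sym loc m with loc m
... | inj₁ (x , b , b′) = inj₁ (x , b′ , b)
... | inj₂ (e , o)      = inj₂ (sym e , subst (Outside _ _) e o)

-- A key outside the window compares in the same way with every key inside it, so a comparison can
-- be lost only when both rows belong to `I`.
Local-order : ∀ {α β} {I : Fin n → Set} {κ κ′} → Local α β I κ κ′ →
              ∀ m m′ → κ m < κ m′ → (I m × I m′) ⊎ κ′ m < κ′ m′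
Local-order loc m m′ lt with loc m | loc m′
... | inj₁ (x , _)          | inj₁ (x′ , _)         = inj₁ (x , x′)
... | inj₁ (_ , (a , _) , _) | inj₂ (_ , inj₁ b)    = contradiction (<-trans (≤-<-trans a lt) b) (<-irrefl refl)
... | inj₁ (_ , _ , (_ , a)) | inj₂ (e , inj₂ b)    = inj₂ (subst (_ <_) e (≤-<-trans a b))
... | inj₂ (e , inj₁ b)     | inj₁ (_ , _ , (a , _)) = inj₂ (subst (_< _) e (<-≤-trans b a))
... | inj₂ (_ , inj₂ b)     | inj₁ (_ , (_ , a) , _) = contradiction (<-≤-trans (<-trans b lt) a) (<-irrefl refl)
... | inj₂ (e , _)          | inj₂ (e′ , _)         = inj₂ (subst₂ _<_ e e′ lt)

slide-order : ∀ {α β} {κ κ′ : Fin n → ℕ} i → Between α β (κ′ i) → Between α β (κ i) →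
              (∀ m → m ≢ i → κ m ≡ κ′ m × Outside α β (κ m)) → SameOrder κ κ′
slide-order {α = α} {β} {κ} {κ′} i b′ b others m m′ = one-way local , one-way (Local-sym local)
  where
  local : Local α β (_≡ i) κ κ′
  local m with m Fin.≟ i
  ... | yes refl = inj₁ (refl , b , b′)
  ... | no m≢i   = inj₂ (others m m≢i)
  one-way : ∀ {κ κ′} → Local α β (_≡ i) κ κ′ → κ m < κ m′ → κ′ m < κ′ m′
  one-way loc lt with Local-order loc m m′ lt
  ... | inj₁ (refl , refl) = contradiction lt (<-irrefl refl)
  ... | inj₂ lt′           = lt′

-- Pairs ordered alike by κ and f

Conc : (κ f : Fin n → ℕ) → Fin n → Fin n → ℕ
Conc κ f m m′ = 𝟙 ((κ m′ <ᵇ κ m) ∧ (f m′ <ᵇ f m))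

-- With `key n 0`, under which later rows have smaller keys, this is the number of inversions of
-- `f`; at an intermediate position the frontier takes the place of the row order.
conc : (κ f : Fin n → ℕ) → ℕ
conc κ f = ∑ λ m → ∑ (Conc κ f m)

conc-cong : {κ κ′ : Fin n → ℕ} → SameOrder κ κ′ → ∀ f → conc κ f ≡ conc κ′ f
conc-cong same f = ∑-cong λ m → ∑-cong λ m′ →
  cong (λ b → 𝟙 (b ∧ (f m′ <ᵇ f m))) (<ᵇ-cong (proj₁ (same m′ m)) (proj₂ (same m′ m)))

∑-transpose : {i k : Fin n} → i ≢ k → (f : Fin n → ℕ) → ∑ f ≡ ∑ (λ m → f (transpose i k ⟨$⟩ʳ m))
∑-transpose {i = i} {k} i≢k f = ∑-pair-cong i≢k
  (λ m m≢i m≢k → cong f (sym (transpose-other m≢i m≢k)))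
  (trans (+-comm (f i) _) (sym (cong₂ (λ a b → f a + f b) (transpose-left i k) (transpose-right i k))))

conc-transpose : {i k : Fin n} → i ≢ k → ∀ κ f →
                 conc κ f ≡ conc (λ m → κ (transpose i k ⟨$⟩ʳ m)) (λ m → f (transpose i k ⟨$⟩ʳ m))
conc-transpose i≢k κ f = trans (∑-transpose i≢k λ m → ∑ (Conc κ f m)) (∑-cong λ m → ∑-transpose i≢k (Conc κ f (transpose _ _ ⟨$⟩ʳ m)))

transpose-involutive : (i k m : Fin n) → transpose i k ⟨$⟩ʳ (transpose i k ⟨$⟩ʳ m) ≡ m
transpose-involutive i k m with among i k m
... | inj₁ (inj₁ refl) = trans (cong (transpose i k ⟨$⟩ʳ_) (transpose-left i k)) (transpose-right i k)
... | inj₁ (inj₂ refl) = trans (cong (transpose i k ⟨$⟩ʳ_) (transpose-right i k)) (transpose-left i k)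
... | inj₂ (m≢i , m≢k) = trans (cong (transpose i k ⟨$⟩ʳ_) (transpose-other m≢i m≢k)) (transpose-other m≢i m≢k)

elbows : Tile → ℕ
elbows elbow = 1
elbows _     = 0

-- Stated for any decision procedure, because the one in `elbowCount` is local to that definition
-- and is supplied by unification.
length-filter-elbow : ∀ {A : Set} (t : A → Tile) (P? : (x : A) → Dec (t x ≡ elbow)) (xs : List A) →
                      length (filter P? xs) ≡ sum (map (elbows ∘ t) xs)
length-filter-elbow t P? [] = refl
length-filter-elbow t P? (x ∷ xs) with P? x
... | yes eq rewrite eq = cong suc (length-filter-elbow t P? xs)
... | no t≢ with t x
...   | elbow = contradiction refl t≢
...   | empty = length-filter-elbow t P? xs
...   | hor   = length-filter-elbow t P? xs
...   | vert  = length-filter-elbow t P? xs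
...   | pivot = length-filter-elbow t P? xs
...   | cross = length-filter-elbow t P? xs

elbowCount-∑ : (D : Tiling n) → elbowCount D ≡ ∑ λ i → ∑ λ j → elbows (D i j)
elbowCount-∑ {n} D = ∑-cong {n} λ i → length-filter-elbow (D i) _ (allFin _)

-- Rank inequalities

count : (Fin n → Bool) → (Fin n → ℕ) → ℕ → ℕ
count P f b = ∑ λ m → 𝟙 (P m ∧ (f m <ᵇ b))

Lower : (Fin n → ℕ) → (Fin n → Bool) → Set
Lower κ P = ∀ m m′ → κ m < κ m′ → P m′ ≡ true → P m ≡ true

-- Under `key n 0` the lower sets are the sets of last rows, and this is the rank criterion for the
-- Bruhat order. Taking for `κ` the key of an intermediate frontier carries the criterion through
-- the sweep.
Dominates : (κ x u : Fin n → ℕ) → Set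
Dominates κ x u = ∀ P → Lower κ P → ∀ b → count P u b ≤ count P x b

Dominates-order : {κ κ′ x u : Fin n → ℕ} → SameOrder κ κ′ → Dominates κ′ x u → Dominates κ x u
Dominates-order same dom P lower = dom P λ m m′ lt → lower m m′ (proj₂ (same m m′) lt)

count-exchange : {P : Fin n → Bool} {x x′ : Fin n → ℕ} {i k : Fin n} → i ≢ k → P i ≡ P k →
                 (∀ m → m ≢ i → m ≢ k → x′ m ≡ x m) →
                 (x′ i ≡ x i × x′ k ≡ x k) ⊎ (x′ i ≡ x k × x′ k ≡ x i) →
                 ∀ b → count P x b ≡ count P x′ b
count-exchange {P = P} {x} {x′} {i} {k} i≢k Pi≡Pk off on b =
  ∑-pair-cong i≢k (λ m m≢i m≢k → cong (λ y → 𝟙 (P m ∧ (y <ᵇ b))) (sym (off m m≢i m≢k))) (pair on)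
  where
  pair : (x′ i ≡ x i × x′ k ≡ x k) ⊎ (x′ i ≡ x k × x′ k ≡ x i) →
         𝟙 (P i ∧ (x i <ᵇ b)) + 𝟙 (P k ∧ (x k <ᵇ b)) ≡ 𝟙 (P i ∧ (x′ i <ᵇ b)) + 𝟙 (P k ∧ (x′ k <ᵇ b))
  pair (inj₁ (e , e′)) rewrite e | e′ = refl
  pair (inj₂ (e , e′)) rewrite e | e′ | Pi≡Pk = +-comm (𝟙 (P k ∧ (x i <ᵇ b))) _

_[_≔_] : (Fin n → Bool) → Fin n → Bool → Fin n → Bool
(P [ i ≔ c ]) m with m Fin.≟ i
... | yes _ = c
... | no  _ = P m

≔-at : (P : Fin n → Bool) (i : Fin n) (c : Bool) → (P [ i ≔ c ]) i ≡ c
≔-at P i c with i Fin.≟ i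
... | yes _ = refl
... | no i≢i = contradiction refl i≢i

≔-off : (P : Fin n → Bool) {i m : Fin n} (c : Bool) → m ≢ i → (P [ i ≔ c ]) m ≡ P m
≔-off P {i} {m} c m≢i with m Fin.≟ i
... | yes m≡i = contradiction m≡i m≢i
... | no _ = refl

count-insert : {P P′ : Fin n → Bool} (i : Fin n) → P i ≡ false → P′ i ≡ true → (∀ m → m ≢ i → P′ m ≡ P m) →
               ∀ f b → count P′ f b ≡ count P f b + 𝟙 (f i <ᵇ b)
count-insert {P = P} {P′} i Pi P′i off f b = begin
  count P′ f b                            ≡⟨ sym (+-identityʳ _) ⟩
  count P′ f b + 0                        ≡⟨ cong (λ c → count P′ f b + 𝟙 (c ∧ (f i <ᵇ b))) (sym Pi) ⟩
  count P′ f b + 𝟙 (P i ∧ (f i <ᵇ b))     ≡⟨ ∑-single i (λ m m≢i → cong (λ c → 𝟙 (c ∧ (f m <ᵇ b))) (off m m≢i)) ⟩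
  count P f b + 𝟙 (P′ i ∧ (f i <ᵇ b))     ≡⟨ cong (λ c → count P f b + 𝟙 (c ∧ (f i <ᵇ b))) P′i ⟩
  count P f b + 𝟙 (f i <ᵇ b)              ∎
  where open ≡-Reasoning

transpose-comm : (i k m : Fin n) → transpose i k ⟨$⟩ʳ m ≡ transpose k i ⟨$⟩ʳ m
transpose-comm i k m with among i k m
... | inj₁ (inj₁ refl) = trans (transpose-left m k) (sym (transpose-right k m))
... | inj₁ (inj₂ refl) = trans (transpose-right i m) (sym (transpose-left m i))
... | inj₂ (m≢i , m≢k) = trans (transpose-other m≢i m≢k) (sym (transpose-other m≢k m≢i))

module _ (P : Fin n → Bool) (upper : ∀ m m′ → m <ᶠ m′ → P m ≡ true → P m′ ≡ true) (b : ℕ) where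

  -- The growth of the length forces `⟦ u ⟧ i < ⟦ u ⟧ k`, as otherwise `Inv-swap-<` read backwards
  -- would make it drop. The swap then moves the smaller label to the later row, which `P` favours,
  -- and `rearrangement` applies.
  count-swap : {u w : Permutation′ n} {i k : Fin n} → i <ᶠ k → (∀ m → w ⟨$⟩ʳ m ≡ u ⟨$⟩ʳ (transpose i k ⟨$⟩ʳ m)) →
               ℓ u < ℓ w → count P ⟦ u ⟧ b ≤ count P ⟦ w ⟧ b
  count-swap {u} {w} {i} {k} i<k h ℓu<ℓw =
    ∑-pair-mono i≢k (λ m m≢i m≢k → ≤-reflexive (cong (λ y → 𝟙 (P m ∧ (y <ᵇ b))) (sym (off m m≢i m≢k)))) pair
    where
    i≢k : i ≢ k
    i≢k refl = <-irrefl refl i<k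
    wi : ⟦ w ⟧ i ≡ ⟦ u ⟧ k
    wi = cong toℕ (trans (h i) (cong (u ⟨$⟩ʳ_) (transpose-left i k)))
    wk : ⟦ w ⟧ k ≡ ⟦ u ⟧ i
    wk = cong toℕ (trans (h k) (cong (u ⟨$⟩ʳ_) (transpose-right i k)))
    off : ∀ m → m ≢ i → m ≢ k → ⟦ w ⟧ m ≡ ⟦ u ⟧ m
    off m m≢i m≢k = cong toℕ (trans (h m) (cong (u ⟨$⟩ʳ_) (transpose-other m≢i m≢k)))
    ui<uk : ⟦ u ⟧ i < ⟦ u ⟧ k
    ui<uk with <-cmp (⟦ u ⟧ i) (⟦ u ⟧ k)
    ... | tri< lt _ _ = lt
    ... | tri≈ _ eq _ = contradiction (⟦⟧-injective u eq) i≢k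
    ... | tri> _ _ gt = contradiction ℓu<ℓw (<-asym (Inv-swap-< {f = ⟦ w ⟧} {⟦ u ⟧} i<k
                          (subst₂ _<_ (sym wi) (sym wk) gt) (sym wk) (sym wi) (λ m m≢i m≢k → sym (off m m≢i m≢k))))
    pair : 𝟙 (P i ∧ (⟦ u ⟧ i <ᵇ b)) + 𝟙 (P k ∧ (⟦ u ⟧ k <ᵇ b)) ≤ 𝟙 (P i ∧ (⟦ w ⟧ i <ᵇ b)) + 𝟙 (P k ∧ (⟦ w ⟧ k <ᵇ b))
    pair rewrite wi | wk = rearrangement {P i} {P k} (upper i k i<k) (<ᵇ-mono {⟦ u ⟧ k} {b} (<-trans ui<uk))

  ≤B⇒count : {u v : Permutation′ n} → u ≤B v → count P ⟦ u ⟧ b ≤ count P ⟦ v ⟧ b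
  ≤B⇒count (≤B-refl e) = ≤-reflexive (∑-cong λ m → cong (λ y → 𝟙 (P m ∧ (toℕ y <ᵇ b))) (e m))
  ≤B⇒count {u} (≤B-step {w = w} (i , j , i≢j , h , lt) c) with <-cmp (toℕ i) (toℕ j)
  ... | tri< i<j _ _ = ≤-trans (count-swap {u} {w} i<j h lt) (≤B⇒count c)
  ... | tri≈ _ i≡j _ = contradiction (Fin.toℕ-injective i≡j) i≢j
  ... | tri> _ _ j<i = ≤-trans (count-swap {u} {w} j<i (λ m → trans (h m) (cong (u ⟨$⟩ʳ_) (transpose-comm i j m))) lt) (≤B⇒count c)

-- Induction on the value `⟦ u ⟧ m`. If `⟦ x ⟧ m` were smaller, the row `m′` where `u` takes that
-- value would by induction have the same image under `x` as `m`; then `m′ ≡ m`, and `u` would take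
-- two values there.
≤⇒≡ : (u x : Permutation′ n) → (∀ m → ⟦ x ⟧ m ≤ ⟦ u ⟧ m) → ∀ m → u ⟨$⟩ʳ m ≡ x ⟨$⟩ʳ m
≤⇒≡ {n} u x x≤u m = sym (<-rec (λ a → ∀ m → ⟦ u ⟧ m ≡ a → x ⟨$⟩ʳ m ≡ u ⟨$⟩ʳ m) step (⟦ u ⟧ m) m refl)
  where
  step : ∀ a → (∀ {c} → c < a → ∀ m → ⟦ u ⟧ m ≡ c → x ⟨$⟩ʳ m ≡ u ⟨$⟩ʳ m) → ∀ m → ⟦ u ⟧ m ≡ a → x ⟨$⟩ʳ m ≡ u ⟨$⟩ʳ m
  step _ rec m refl with m≤n⇒m<n∨m≡n (x≤u m)
  ... | inj₂ eq = Fin.toℕ-injective eq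
  ... | inj₁ lt = contradiction (cong ⟦ u ⟧ m′≡m) (<⇒≢ (subst (_< ⟦ u ⟧ m) (sym um′) lt))
    where
    m′ : Fin n
    m′ = u ⟨$⟩ˡ (x ⟨$⟩ʳ m)
    um′ : ⟦ u ⟧ m′ ≡ ⟦ x ⟧ m
    um′ = cong toℕ (inverseʳ u)
    m′≡m : m′ ≡ m
    m′≡m = ⟨$⟩ʳ-injective x (trans (rec lt m′ um′) (inverseʳ u))

-- Rothe tilings and the labels of their pipes

module Rothe (u : Permutation′ n) where

  -- `IsRothe` indexed by the tile: one match gives the tile together with the position of the box,
  -- and overwriting a tile asks for a single new proof.
  data Box (i j : Fin n) : Tile → Set where
    pivot : i ≡ u ⟨$⟩ˡ j → Box i j pivot
    empty : (u ⟨$⟩ˡ j) <ᶠ i → toℕ j < ⟦ u ⟧ i → Box i j empty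
    hor   : (u ⟨$⟩ˡ j) <ᶠ i → ⟦ u ⟧ i < toℕ j → Box i j hor
    vert  : i <ᶠ (u ⟨$⟩ˡ j) → toℕ j < ⟦ u ⟧ i → Box i j vert
    cross : i <ᶠ (u ⟨$⟩ˡ j) → ⟦ u ⟧ i < toℕ j → Box i j cross
    elbow : i <ᶠ (u ⟨$⟩ˡ j) → ⟦ u ⟧ i < toℕ j → Box i j elbow

  column : (j : Fin n) → ⟦ u ⟧ (u ⟨$⟩ˡ j) ≡ toℕ j
  column j = cong toℕ (inverseʳ u)

  column⁻¹ : {m j : Fin n} → ⟦ u ⟧ m ≡ toℕ j → m ≡ u ⟨$⟩ˡ j
  column⁻¹ {j = j} e = ⟦⟧-injective u (trans e (sym (column j)))

  IsRothe⇒Box : {D : Tiling n} → IsRothe u D → ∀ i j → Box i j (D i j)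
  IsRothe⇒Box {D} (p , e , h , v , f) i j with <-cmp (toℕ i) (toℕ (u ⟨$⟩ˡ j)) | <-cmp (⟦ u ⟧ i) (toℕ j)
  ... | tri≈ _ i≡k _ | _ with refl ← Fin.toℕ-injective i≡k =
        subst (Box i j) (sym (trans (cong (D i) (sym (inverseʳ u))) (p i))) (pivot refl)
  ... | tri< i<k _ _ | tri≈ _ eq _ = contradiction (cong toℕ (column⁻¹ eq)) (<⇒≢ i<k)
  ... | tri> _ _ k<i | tri≈ _ eq _ = contradiction (cong toℕ (column⁻¹ eq)) (>⇒≢ k<i)
  ... | tri> _ _ k<i | tri< u<j _ _ = subst (Box i j) (sym (h i j k<i u<j)) (hor k<i u<j)
  ... | tri> _ _ k<i | tri> _ _ j<u = subst (Box i j) (sym (e i j k<i j<u)) (empty k<i j<u)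
  ... | tri< i<k _ _ | tri> _ _ j<u = subst (Box i j) (sym (v i j i<k j<u)) (vert i<k j<u)
  ... | tri< i<k _ _ | tri< u<j _ _ with f i j i<k u<j
  ...   | inj₁ eq = subst (Box i j) (sym eq) (cross i<k u<j)
  ...   | inj₂ eq = subst (Box i j) (sym eq) (elbow i<k u<j)

  Box⇒IsRothe : {D : Tiling n} → (∀ i j → Box i j (D i j)) → IsRothe u D
  Box⇒IsRothe {D} box = p , e , h , v , f
    where
    p : ∀ i → D i (u ⟨$⟩ʳ i) ≡ pivot
    p i with D i (u ⟨$⟩ʳ i) | box i (u ⟨$⟩ʳ i)
    ... | _ | pivot _ = refl
    ... | _ | empty _ a = contradiction a (<-irrefl refl)
    ... | _ | hor   _ a = contradiction a (<-irrefl refl)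
    ... | _ | vert  _ a = contradiction a (<-irrefl refl)
    ... | _ | cross _ a = contradiction a (<-irrefl refl)
    ... | _ | elbow _ a = contradiction a (<-irrefl refl)
    e : ∀ i j → (u ⟨$⟩ˡ j) <ᶠ i → toℕ j < ⟦ u ⟧ i → D i j ≡ empty
    e i j a b with D i j | box i j
    ... | _ | pivot i≡k = contradiction (cong toℕ i≡k) (>⇒≢ a)
    ... | _ | empty _ _ = refl
    ... | _ | hor   _ c = contradiction b (<-asym c)
    ... | _ | vert  c _ = contradiction a (<-asym c)
    ... | _ | cross c _ = contradiction a (<-asym c)
    ... | _ | elbow c _ = contradiction a (<-asym c)
    h : ∀ i j → (u ⟨$⟩ˡ j) <ᶠ i → ⟦ u ⟧ i < toℕ j → D i j ≡ hor
    h i j a b with D i j | box i j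
    ... | _ | pivot i≡k = contradiction (cong toℕ i≡k) (>⇒≢ a)
    ... | _ | empty _ c = contradiction b (<-asym c)
    ... | _ | hor   _ _ = refl
    ... | _ | vert  c _ = contradiction a (<-asym c)
    ... | _ | cross c _ = contradiction a (<-asym c)
    ... | _ | elbow c _ = contradiction a (<-asym c)
    v : ∀ i j → i <ᶠ (u ⟨$⟩ˡ j) → toℕ j < ⟦ u ⟧ i → D i j ≡ vert
    v i j a b with D i j | box i j
    ... | _ | pivot i≡k = contradiction (cong toℕ i≡k) (<⇒≢ a)
    ... | _ | empty c _ = contradiction a (<-asym c)
    ... | _ | hor   c _ = contradiction a (<-asym c)
    ... | _ | vert  _ _ = refl
    ... | _ | cross _ c = contradiction b (<-asym c)
    ... | _ | elbow _ c = contradiction b (<-asym c)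
    f : ∀ i j → i <ᶠ (u ⟨$⟩ˡ j) → ⟦ u ⟧ i < toℕ j → (D i j ≡ cross) ⊎ (D i j ≡ elbow)
    f i j a b with D i j | box i j
    ... | _ | pivot i≡k = contradiction (cong toℕ i≡k) (<⇒≢ a)
    ... | _ | empty c _ = contradiction a (<-asym c)
    ... | _ | hor   c _ = contradiction a (<-asym c)
    ... | _ | vert  _ c = contradiction b (<-asym c)
    ... | _ | cross _ _ = inj₁ refl
    ... | _ | elbow _ _ = inj₂ refl

  act : Tile → Fin n → Fin n → Permutation′ n → Permutation′ n
  act elbow i k w = transpose i k ∘ₚ w
  act _     _ _ w = w

  -- Just before box (i , j) is read, W D i j sends a row m to the label of the pipe that would
  -- leave in row m if every box from there on were a cross.
  W : Tiling n → ℕ → ℕ → Permutation′ n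
  W D = Sweep.before (λ i j → act (D i j) i (u ⟨$⟩ˡ j)) u

  W-step : (D : Tiling n) (i j : Fin n) →
           W D (toℕ i) (suc (toℕ j)) ≡ act (D i j) i (u ⟨$⟩ˡ j) (W D (toℕ i) (toℕ j))
  W-step D = Sweep.before-step (λ i j → act (D i j) i (u ⟨$⟩ˡ j)) u

  -- If all boxes from `(i , j)` on were crosses, the pipe at the left edge would run to the end of
  -- row `i`, and the pipe at the top edge would descend to the pivot of column `j` and leave in row
  -- `u ⟨$⟩ˡ j`; hence these two values of `W`.
  left top : Tiling n → Fin n → Fin n → Fin n
  left D i j = W D (toℕ i) (toℕ j) ⟨$⟩ʳ i
  top  D i j = W D (toℕ i) (toℕ j) ⟨$⟩ʳ (u ⟨$⟩ˡ j)

  -- The edge at which pipe W D i j m enters the unread part of the array.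
  data Edge (i j : ℕ) (m : Fin n) : ℕ → ℕ → Entry → Set where
    out   : toℕ m < i → Edge i j m (toℕ m) n fromLeft
    carry : toℕ m ≡ i → ⟦ u ⟧ m < j → Edge i j m i j fromLeft
    below : i < toℕ m → ⟦ u ⟧ m < j → Edge i j m (suc i) (⟦ u ⟧ m) fromTop
    above : i ≤ toℕ m → j ≤ ⟦ u ⟧ m → Edge i j m i (⟦ u ⟧ m) fromTop

  -- Following the pipes of a Rothe tiling

  module Trace (D : Tiling n) (box : ∀ i j → Box i j (D i j)) where

    Labelled : ℕ × ℕ → Fin n → Set
    Labelled b p = Σ (Fin n) λ i → Σ (Fin n) λ j →
      (b ≡ (toℕ i , toℕ j)) × ((p ≡ left D i j) ⊎ (p ≡ top D i j))

    -- `pre` is the part of the pipe already traversed and `f` the fuel left. Each step lowers `f`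
    -- and raises `a + b` by one, so the bound persists; inside the array `a + b` is below `2 * n`,
    -- hence the fuel does not run out there.
    Through : Fin n → ℕ → ℕ → Entry → Set
    Through p a b e = Σ ℕ λ f → Σ (List (ℕ × ℕ)) λ pre →
      pipe D p ≡ prepend pre (follow D f a b e) × 2 * n ≤ f + (a + b) × (∀ {x} → x ∈ pre → Labelled x p)

    fuel : (i j : Fin n) → ¬ (2 * n ≤ toℕ i + toℕ j)
    fuel i j = <⇒≱ (<-≤-trans (+-mono-< (Fin.toℕ<n i) (Fin.toℕ<n j)) (≤-reflexive (cong (n +_) (sym (+-identityʳ n)))))

    advance : ∀ {p i j e e′} → Moves (D i j) e e′ → (p ≡ left D i j) ⊎ (p ≡ top D i j) →
              Through p (toℕ i) (toℕ j) e → Through p (nextRow (toℕ i) e′) (nextCol (toℕ j) e′) e′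
    advance {i = i} {j} mv lab (zero , pre , eq , le , labs) = contradiction le (fuel i j)
    advance {p} {i} {j} {e} {e′} mv lab (suc f , pre , eq , le , labs) =
      f , pre ++ (toℕ i , toℕ j) ∷ [] ,
      trans eq (trans (cong (prepend pre) (follow-step D i j mv f)) (prepend-++ pre _ _)) ,
      ≤-trans le (≤-reflexive (trans (sym (+-suc f _)) (cong (f +_) (sym (next-sum (toℕ i) (toℕ j) e′))))) ,
      λ x∈ → labelled (∈-++⁻ pre x∈)
      where
      labelled : ∀ {x} → x ∈ pre ⊎ x ∈ (toℕ i , toℕ j) ∷ [] → Labelled x p
      labelled (inj₁ x∈)          = labs x∈
      labelled (inj₂ (here refl)) = i , j , refl , lab

    passes : ∀ {p i j e e′} → Moves (D i j) e e′ → Through p (toℕ i) (toℕ j) e → (toℕ i , toℕ j) ∈ boxesOf D p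
    passes {i = i} {j} mv (zero , pre , eq , le , labs) = contradiction le (fuel i j)
    passes {i = i} {j} mv (suc f , pre , eq , le , labs) =
      subst ((toℕ i , toℕ j) ∈_) (cong proj₁ (sym (trans eq (cong (prepend pre) (follow-step D i j mv f)))))
        (∈-++⁺ʳ pre (here refl))

    Traced : ℕ → ℕ → Permutation′ n → Set
    Traced i j w = ∀ m {a b e} → Edge i j m a b e → Through (w ⟨$⟩ʳ m) a b e

    seen-or-here : ∀ m (j : Fin n) → ⟦ u ⟧ m < suc (toℕ j) → ⟦ u ⟧ m < toℕ j ⊎ m ≡ u ⟨$⟩ˡ j
    seen-or-here m j lt with m<1+n⇒m<n∨m≡n lt
    ... | inj₁ lt′ = inj₁ lt′
    ... | inj₂ eq  = inj₂ (column⁻¹ eq)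

    module _ (i j : Fin n) where

      private
        k = u ⟨$⟩ˡ j
        w = W D (toℕ i) (toℕ j)

      atTop : toℕ i ≤ toℕ k → Edge (toℕ i) (toℕ j) k (toℕ i) (toℕ j) fromTop
      atTop i≤k = subst (λ c → Edge (toℕ i) (toℕ j) k (toℕ i) c fromTop) (column j) (above i≤k (≤-reflexive (sym (column j))))

      -- For all tiles but the elbow each row keeps its pipe. Each of the three motions is demanded
      -- only where such a pipe is present, so an empty box satisfies all of them vacuously.
      traced-straight : (⟦ u ⟧ i < toℕ j → Moves (D i j) fromLeft fromLeft) →
                        (i ≡ k → Moves (D i j) fromTop fromLeft) →
                        (toℕ i < toℕ k → Moves (D i j) fromTop fromTop) →
                        Traced (toℕ i) (toℕ j) w → Traced (toℕ i) (suc (toℕ j)) w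
      traced-straight right turn down tr m (out m<i) = tr m (out m<i)
      traced-straight right turn down tr m (above i≤m j<u) = tr m (above i≤m (<⇒≤ j<u))
      traced-straight right turn down tr m (carry m≡i u≤j) with Fin.toℕ-injective m≡i
      ... | refl with seen-or-here m j u≤j
      ...   | inj₁ u<j  = advance (right u<j) (inj₁ refl) (tr m (carry refl u<j))
      ...   | inj₂ refl = advance (turn refl) (inj₁ refl) (tr m (atTop ≤-refl))
      traced-straight right turn down tr m (below i<m u≤j) with seen-or-here m j u≤j
      ... | inj₁ u<j  = tr m (below i<m u<j)
      ... | inj₂ refl = subst (λ c → Through (w ⟨$⟩ʳ k) (suc (toℕ i)) c fromTop) (sym (column j))
                          (advance (down i<m) (inj₂ refl) (tr k (atTop (<⇒≤ i<m))))

      -- The pipe from the top continues in row `i` and the pipe from the left continues down column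
      -- `j`; each takes the place that the other would have after a cross, hence the transposition
      -- of `i` and `k`.
      traced-elbow : D i j ≡ elbow → toℕ i < toℕ k → ⟦ u ⟧ i < toℕ j →
                     Traced (toℕ i) (toℕ j) w → Traced (toℕ i) (suc (toℕ j)) (transpose i k ∘ₚ w)
      traced-elbow eq i<k ui<j tr = λ where
          m (out m<i) → unmoved m (λ { refl → <-irrefl refl m<i }) (λ { refl → <-asym m<i i<k }) (out m<i)
          m (above i≤m j<u) → unmoved m (λ { refl → <-asym ui<j j<u }) (λ { refl → <-irrefl (sym (column j)) j<u }) (above i≤m (<⇒≤ j<u))
          m (carry m≡i _) → turned m (Fin.toℕ-injective m≡i)
          m (below i<m u≤j) → down m i<m (seen-or-here m j u≤j)
        where
        Through′ : Fin n → ℕ → ℕ → Entry → Set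
        Through′ m = Through (w ⟨$⟩ʳ (transpose i k ⟨$⟩ʳ m))
        unmoved : ∀ m {a b e} → m ≢ i → m ≢ k → Edge (toℕ i) (toℕ j) m a b e → Through′ m a b e
        unmoved m m≢i m≢k ed rewrite transpose-other m≢i m≢k = tr m ed
        turned : ∀ m → m ≡ i → Through′ m (toℕ i) (suc (toℕ j)) fromLeft
        turned m refl rewrite transpose-left i k =
          advance (subst (λ t → Moves t fromTop fromLeft) (sym eq) elbow-→) (inj₂ refl) (tr k (atTop (<⇒≤ i<k)))
        down : ∀ m → toℕ i < toℕ m → ⟦ u ⟧ m < toℕ j ⊎ m ≡ k → Through′ m (suc (toℕ i)) (⟦ u ⟧ m) fromTop
        down m i<m (inj₁ u<j) = unmoved m (λ { refl → <-irrefl refl i<m }) (λ { refl → <-irrefl (column j) u<j }) (below i<m u<j)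
        down m i<m (inj₂ refl) rewrite transpose-right i k | column j =
          advance (subst (λ t → Moves t fromLeft fromTop) (sym eq) elbow-↓) (inj₁ refl) (tr i (carry refl ui<j))

      traced-step : Traced (toℕ i) (toℕ j) w → Traced (toℕ i) (suc (toℕ j)) (W D (toℕ i) (suc (toℕ j)))
      traced-step tr = subst (Traced (toℕ i) (suc (toℕ j))) (sym (W-step D i j)) (by-tile (D i j) refl (box i j))
        where
        by-tile : ∀ t → D i j ≡ t → Box i j t → Traced (toℕ i) (suc (toℕ j)) (act t i k w)
        by-tile _ eq (pivot refl) = traced-straight
          (λ lt → contradiction (column j) (<⇒≢ lt)) (λ _ → subst (λ t → Moves t _ _) (sym eq) pivot-→) (λ lt → contradiction refl (<⇒≢ lt)) tr
        by-tile _ eq (empty k<i j<u) = traced-straight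
          (λ lt → contradiction j<u (<-asym lt)) (λ { i≡k → contradiction (cong toℕ i≡k) (>⇒≢ k<i) }) (λ lt → contradiction k<i (<-asym lt)) tr
        by-tile _ eq (hor k<i u<j) = traced-straight
          (λ _ → subst (λ t → Moves t _ _) (sym eq) hor-→) (λ { i≡k → contradiction (cong toℕ i≡k) (>⇒≢ k<i) }) (λ lt → contradiction k<i (<-asym lt)) tr
        by-tile _ eq (vert i<k j<u) = traced-straight
          (λ lt → contradiction j<u (<-asym lt)) (λ { i≡k → contradiction (cong toℕ i≡k) (<⇒≢ i<k) }) (λ _ → subst (λ t → Moves t _ _) (sym eq) vert-↓) tr
        by-tile _ eq (cross i<k u<j) = traced-straight
          (λ _ → subst (λ t → Moves t _ _) (sym eq) cross-→) (λ { i≡k → contradiction (cong toℕ i≡k) (<⇒≢ i<k) }) (λ _ → subst (λ t → Moves t _ _) (sym eq) cross-↓) tr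
        by-tile _ eq (elbow i<k u<j) = traced-elbow eq i<k u<j tr

    traced-start : Traced 0 0 u
    traced-start m (above z≤n z≤n) = 2 * n , [] , refl , m≤m+n (2 * n) _ , λ ()

    traced-next : ∀ i → Traced i n (W D i n) → Traced (suc i) 0 (W D i n)
    traced-next i tr m (above i<m _) = tr m (below i<m (Fin.toℕ<n _))
    traced-next i tr m (out m≤i) with m<1+n⇒m<n∨m≡n m≤i
    ... | inj₁ m<i  = tr m (out m<i)
    ... | inj₂ refl = tr m (carry refl (Fin.toℕ<n _))

    Tracedᵂ : ℕ → ℕ → Set
    Tracedᵂ i j = Traced i j (W D i j)

    traced-box : ∀ i j → Tracedᵂ (toℕ i) (toℕ j)
    traced-box i j = sweep-box Tracedᵂ traced-start traced-step (λ i → traced-next (toℕ i)) i (<⇒≤ (Fin.toℕ<n j))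

    traced-end : ∀ m → Through (W D n 0 ⟨$⟩ʳ m) (toℕ m) n fromLeft
    traced-end m = sweep-start Tracedᵂ traced-start traced-step (λ i → traced-next (toℕ i)) ≤-refl m (out (Fin.toℕ<n m))

    exit : ∀ m → exitOf D (W D n 0 ⟨$⟩ʳ m) ≡ exitRight (toℕ m)
    exit m with f , pre , eq , _ ← traced-end m =
      trans (cong proj₂ eq) (cong (proj₂ ∘ prepend pre) (follow-exit D m f))

    labelled : ∀ {b p} → b ∈ boxesOf D p → Labelled b p
    labelled {b} {p} b∈ with f , pre , eq , _ , labs ← traced-end (W D n 0 ⟨$⟩ˡ p)
                        rewrite inverseʳ (W D n 0) {p} | follow-exit D (W D n 0 ⟨$⟩ˡ p) f =
      labs (subst (b ∈_) (trans (cong proj₁ eq) (++-identityʳ pre)) b∈)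

    meet : ∀ {i j} → D i j ≡ cross ⊎ D i j ≡ elbow → i <ᶠ (u ⟨$⟩ˡ j) → ⟦ u ⟧ i < toℕ j →
           (toℕ i , toℕ j) ∈ boxesOf D (left D i j) × (toℕ i , toℕ j) ∈ boxesOf D (top D i j)
    meet {i} {j} t i<k u<j = by-tile t (traced-box i j i (carry refl u<j)) (traced-box i j (u ⟨$⟩ˡ j) (atTop i j (<⇒≤ i<k)))
      where
      by-tile : D i j ≡ cross ⊎ D i j ≡ elbow →
                Through (left D i j) (toℕ i) (toℕ j) fromLeft → Through (top D i j) (toℕ i) (toℕ j) fromTop →
                (toℕ i , toℕ j) ∈ boxesOf D (left D i j) × (toℕ i , toℕ j) ∈ boxesOf D (top D i j)
      by-tile (inj₁ eq) l t = passes (subst (λ x → Moves x fromLeft fromLeft) (sym eq) cross-→) l ,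
                              passes (subst (λ x → Moves x fromTop fromTop) (sym eq) cross-↓) t
      by-tile (inj₂ eq) l t = passes (subst (λ x → Moves x fromLeft fromTop) (sym eq) elbow-↓) l ,
                              passes (subst (λ x → Moves x fromTop fromLeft) (sym eq) elbow-→) t

  -- The frontier between read and unread boxes, ordered from the southwest to the northeast

  -- The position of row m on the frontier just before box (i , j) is read: 1 + 2c at the top
  -- edge of a box in column c, 2j at the left edge of box (i , j), beyond 2n on the right
  -- boundary of the array.
  key : ℕ → ℕ → Fin n → ℕ
  key i j m =
    if toℕ m <ᵇ i then dbl n + (n ∸ toℕ m) else
    if (toℕ m <ᵇ suc i) ∧ (⟦ u ⟧ m <ᵇ j) then dbl j else suc (dbl (⟦ u ⟧ m))

  key-out : ∀ {i j m} → toℕ m < i → key i j m ≡ dbl n + (n ∸ toℕ m)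
  key-out m<i rewrite <ᵇ-true m<i = refl

  key-carry : ∀ {j m} → ⟦ u ⟧ m < j → key (toℕ m) j m ≡ dbl j
  key-carry {j} {m} u<j rewrite <ᵇ-false (<-irrefl {toℕ m} refl) | <ᵇ-true (n<1+n (toℕ m)) | <ᵇ-true u<j = refl

  key-below : ∀ {i j m} → i < toℕ m → key i j m ≡ suc (dbl (⟦ u ⟧ m))
  key-below {i} {j} {m} i<m rewrite <ᵇ-false (<-asym i<m) | <ᵇ-false {toℕ m} {suc i} (λ lt → <⇒≱ i<m (≤-pred lt)) = refl

  key-waiting : ∀ {j m} → j ≤ ⟦ u ⟧ m → key (toℕ m) j m ≡ suc (dbl (⟦ u ⟧ m))
  key-waiting {j} {m} j≤u rewrite <ᵇ-false (<-irrefl {toℕ m} refl) | <ᵇ-true (n<1+n (toℕ m)) | <ᵇ-false {⟦ u ⟧ m} {j} (≤⇒≯ j≤u) = refl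

  key-column : ∀ {i m} j j′ → m ≢ i → key (toℕ i) j m ≡ key (toℕ i) j′ m
  key-column {i} {m} j j′ m≢i with <-cmp (toℕ m) (toℕ i)
  ... | tri< m<i _ _ = trans (key-out {j = j} m<i) (sym (key-out {j = j′} m<i))
  ... | tri≈ _ m≡i _ = contradiction (Fin.toℕ-injective m≡i) m≢i
  ... | tri> _ _ i<m = trans (key-below {j = j} i<m) (sym (key-below {j = j′} i<m))

  -- The window reaches from the left edge to the right edge of box `(i , j)`. Rows above `i` have
  -- keys beyond `dbl n`, later rows have the odd key of their column, and of these only the key of
  -- column `j` lies in the window.
  key-gap : ∀ {m} (i j : Fin n) → m ≢ i → (m ≡ u ⟨$⟩ˡ j → toℕ m < toℕ i) →
            Outside (dbl (toℕ j)) (dbl (suc (toℕ j))) (key (toℕ i) (toℕ j) m)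
  key-gap {m} i j m≢i h with <-cmp (toℕ m) (toℕ i)
  ... | tri≈ _ m≡i _ = contradiction (Fin.toℕ-injective m≡i) m≢i
  ... | tri< m<i _ _ rewrite key-out {j = toℕ j} m<i =
        inj₂ (≤-<-trans (dbl-mono (Fin.toℕ<n j)) (m<m+n (dbl n) (m<n⇒0<n∸m (Fin.toℕ<n m))))
  ... | tri> ≮i _ i<m rewrite key-below {j = toℕ j} i<m with <-cmp (⟦ u ⟧ m) (toℕ j)
  ...   | tri< u<j _ _ = inj₁ (dbl-mono u<j)
  ...   | tri≈ _ u≡j _ = contradiction (h (column⁻¹ u≡j)) ≮i
  ...   | tri> _ _ j<u = inj₂ (s≤s (dbl-mono j<u))

  -- No two pipes pass each other here. Either row `i` has not reached its pivot and nothing moves,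
  -- or its key slides to the right edge of the box while column `j` holds no pipe of another row,
  -- so that the window is free.
  still : (i j : Fin n) → toℕ (u ⟨$⟩ˡ j) ≤ toℕ i ⊎ toℕ j < ⟦ u ⟧ i →
          SameOrder (key (toℕ i) (toℕ j)) (key (toℕ i) (suc (toℕ j)))
  still i j h with ⟦ u ⟧ i ≤? toℕ j
  ... | no u≰j = SameOrder-cong unchanged
    where
    unchanged : ∀ m → key (toℕ i) (toℕ j) m ≡ key (toℕ i) (suc (toℕ j)) m
    unchanged m with m Fin.≟ i
    ... | yes refl = trans (key-waiting (<⇒≤ (≰⇒> u≰j))) (sym (key-waiting (≰⇒> u≰j)))
    ... | no m≢i   = key-column (toℕ j) (suc (toℕ j)) m≢i
  still i j (inj₂ j<u) | yes u≤j = contradiction u≤j (<⇒≱ j<u)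
  still i j (inj₁ k≤i) | yes u≤j = slide-order {α = dbl (toℕ j)} {dbl (suc (toℕ j))} i
    (subst (Between _ _) (sym (key-carry (s≤s u≤j))) (n≤1+n _ ⟨≤⟩ n≤1+n _ , ≤-refl)) before
    λ m m≢i → key-column (toℕ j) (suc (toℕ j)) m≢i ,
      key-gap i j m≢i (λ { refl → ≤∧≢⇒< k≤i (m≢i ∘ Fin.toℕ-injective) })
    where
    _⟨≤⟩_ = ≤-trans
    before : Between (dbl (toℕ j)) (dbl (suc (toℕ j))) (key (toℕ i) (toℕ j) i)
    before with m≤n⇒m<n∨m≡n u≤j
    ... | inj₁ u<j rewrite key-carry u<j = ≤-refl , (n≤1+n _ ⟨≤⟩ n≤1+n _)
    ... | inj₂ u≡j rewrite key-waiting {toℕ j} {i} (≤-reflexive (sym u≡j)) | u≡j = n≤1+n _ , n≤1+n _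

  next-row : (i : Fin n) → SameOrder (key (toℕ i) n) (key (suc (toℕ i)) 0)
  next-row i = slide-order {α = dbl n} {dbl n + (n ∸ toℕ i)} i
    (subst (Between _ _) (sym (key-out (n<1+n (toℕ i)))) (m≤m+n _ _ , ≤-refl))
    (subst (Between _ _) (sym (key-carry {n} {i} (Fin.toℕ<n _))) (≤-refl , m≤m+n _ _))
    others
    where
    others : ∀ m → m ≢ i → key (toℕ i) n m ≡ key (suc (toℕ i)) 0 m × Outside (dbl n) (dbl n + (n ∸ toℕ i)) (key (toℕ i) n m)
    others m m≢i with <-cmp (toℕ m) (toℕ i)
    ... | tri≈ _ m≡i _ = contradiction (Fin.toℕ-injective m≡i) m≢i
    ... | tri< m<i _ _ rewrite key-out {j = n} m<i | key-out {j = 0} (<-trans m<i (n<1+n _)) =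
          refl , inj₂ (+-monoʳ-< (dbl n) (∸-monoʳ-< m<i (<⇒≤ (Fin.toℕ<n i))))
    ... | tri> _ _ i<m rewrite key-below {j = n} i<m with m≤n⇒m<n∨m≡n i<m
    ...   | inj₁ si<m rewrite key-below {j = 0} si<m = refl , inj₁ (dbl-mono (Fin.toℕ<n (u ⟨$⟩ʳ m)))
    ...   | inj₂ si≡m rewrite si≡m | key-waiting {0} {m} z≤n = refl , inj₁ (dbl-mono (Fin.toℕ<n (u ⟨$⟩ʳ m)))

  key-mono : (i j : Fin n) → ∀ m → key (toℕ i) (toℕ j) m ≤ key (toℕ i) (suc (toℕ j)) m
  key-mono i j m with m Fin.≟ i
  ... | no m≢i = ≤-reflexive (key-column (toℕ j) (suc (toℕ j)) m≢i)
  ... | yes refl with <-cmp (⟦ u ⟧ m) (toℕ j)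
  ...   | tri< u<j _ _ rewrite key-carry u<j | key-carry {suc (toℕ j)} {m} (m<n⇒m<1+n u<j) = ≤-trans (n≤1+n _) (n≤1+n _)
  ...   | tri≈ _ u≡j _ rewrite key-waiting {toℕ j} {m} (≤-reflexive (sym u≡j)) | key-carry {suc (toℕ j)} {m} (s≤s (≤-reflexive u≡j)) | u≡j = n≤1+n _
  ...   | tri> _ _ j<u rewrite key-waiting {toℕ j} {m} (<⇒≤ j<u) | key-waiting {suc (toℕ j)} {m} j<u = ≤-refl

  key-mono-row : (i : Fin n) → ∀ m → key (toℕ i) n m ≤ key (suc (toℕ i)) 0 m
  key-mono-row i m with <-cmp (toℕ m) (toℕ i)
  ... | tri< m<i _ _ rewrite key-out {j = n} m<i | key-out {j = 0} (m<n⇒m<1+n m<i) = ≤-refl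
  ... | tri≈ _ m≡i _ with refl ← Fin.toℕ-injective m≡i rewrite key-carry {n} {m} (Fin.toℕ<n _) | key-out {j = 0} (n<1+n (toℕ m)) = m≤m+n _ _
  ... | tri> _ _ i<m rewrite key-below {j = n} i<m with m≤n⇒m<n∨m≡n i<m
  ...   | inj₁ si<m rewrite key-below {j = 0} si<m = ≤-refl
  ...   | inj₂ si≡m rewrite si≡m | key-waiting {0} {m} z≤n = ≤-refl

  key-start : ∀ m → key 0 0 m ≡ suc (dbl (⟦ u ⟧ m))
  key-start m with m≤n⇒m<n∨m≡n (z≤n {toℕ m})
  ... | inj₁ 0<m = key-below {j = 0} 0<m
  ... | inj₂ 0≡m = subst (λ i → key i 0 m ≡ suc (dbl (⟦ u ⟧ m))) (sym 0≡m) (key-waiting z≤n)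

  key-end : ∀ m m′ → (toℕ m < toℕ m′ → key n 0 m′ < key n 0 m) × (key n 0 m′ < key n 0 m → toℕ m < toℕ m′)
  key-end m m′ rewrite key-out {j = 0} (Fin.toℕ<n m) | key-out {j = 0} (Fin.toℕ<n m′) =
    (λ m<m′ → +-monoʳ-< (dbl n) (∸-monoʳ-< m<m′ (<⇒≤ (Fin.toℕ<n m′)))) ,
    (λ lt → ≰⇒> λ m′≤m → <⇒≱ (+-cancelˡ-< (dbl n) _ _ lt) (∸-monoʳ-≤ n m′≤m))

  -- At a box (i , j) holding a cross or an elbow, the rows i and u⁻¹ j are adjacent on the
  -- frontier, and reading the box exchanges them.
  module Crossing (i j : Fin n) (i<k : i <ᶠ (u ⟨$⟩ˡ j)) (u<j : ⟦ u ⟧ i < toℕ j) where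

    private
      k = u ⟨$⟩ˡ j
      τ = transpose i k ⟨$⟩ʳ_
      κ κ′ : Fin n → ℕ
      κ  = key (toℕ i) (toℕ j)
      κ′ = key (toℕ i) (suc (toℕ j))
      α β : ℕ
      α = dbl (toℕ j)
      β = dbl (suc (toℕ j))
      I : Fin n → Set
      I m = m ≡ i ⊎ m ≡ k

    i≢k : i ≢ k
    i≢k i≡k = <⇒≢ i<k (cong toℕ i≡k)

    κi : κ i ≡ α
    κi = key-carry u<j

    κk : κ k ≡ suc α
    κk = trans (key-below {j = toℕ j} i<k) (cong (suc ∘ dbl) (column j))

    κ′i : κ′ i ≡ β
    κ′i = key-carry (m<n⇒m<1+n u<j)

    κ′k : κ′ k ≡ suc α
    κ′k = trans (key-below {j = suc (toℕ j)} i<k) (cong (suc ∘ dbl) (column j))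

    κi<κk : κ i < κ k
    κi<κk rewrite κi | κk = ≤-refl

    κ′k<κ′i : κ′ k < κ′ i
    κ′k<κ′i rewrite κ′i | κ′k = ≤-refl

    mover : ∀ {m} → I m → Between α β (κ m) × Between α β (κ′ m)
    mover (inj₁ refl) rewrite κi | κ′i = (≤-refl , ≤-trans (n≤1+n _) (n≤1+n _)) , (≤-trans (n≤1+n _) (n≤1+n _) , ≤-refl)
    mover (inj₂ refl) rewrite κk | κ′k = (n≤1+n _ , n≤1+n _) , (n≤1+n _ , n≤1+n _)

    others : ∀ {m} → m ≢ i → m ≢ k → κ m ≡ κ′ m × Outside α β (κ m)
    others m≢i m≢k = key-column (toℕ j) (suc (toℕ j)) m≢i , key-gap i j m≢i (λ m≡k → contradiction m≡k m≢k)

    local : Local α β I κ κ′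
    local m with among i k m
    ... | inj₁ m∈I         = inj₁ (m∈I , mover m∈I)
    ... | inj₂ (m≢i , m≢k) = inj₂ (others m≢i m≢k)

    local-τ : Local α β I κ (κ′ ∘ τ)
    local-τ m with among i k m
    ... | inj₁ (inj₁ refl) rewrite transpose-left i k =
          inj₁ (inj₁ refl , proj₁ (mover (inj₁ refl)) , proj₂ (mover (inj₂ refl)))
    ... | inj₁ (inj₂ refl) rewrite transpose-right i k =
          inj₁ (inj₂ refl , proj₁ (mover (inj₂ refl)) , proj₂ (mover (inj₁ refl)))
    ... | inj₂ (m≢i , m≢k) rewrite transpose-other m≢i m≢k = inj₂ (others m≢i m≢k)

    cross-order : ∀ m m′ → κ m < κ m′ → (m ≡ i × m′ ≡ k) ⊎ κ′ m < κ′ m′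
    cross-order m m′ lt with Local-order local m m′ lt
    ... | inj₂ lt′ = inj₂ lt′
    ... | inj₁ (inj₁ m≡i  , inj₂ m′≡k)  = inj₁ (m≡i , m′≡k)
    ... | inj₁ (inj₁ refl , inj₁ refl)  = contradiction lt (<-irrefl refl)
    ... | inj₁ (inj₂ refl , inj₂ refl)  = contradiction lt (<-irrefl refl)
    ... | inj₁ (inj₂ refl , inj₁ refl)  = contradiction lt (<-asym κi<κk)

    cross-order⁻¹ : ∀ m m′ → κ′ m < κ′ m′ → (m ≡ k × m′ ≡ i) ⊎ κ m < κ m′
    cross-order⁻¹ m m′ lt with Local-order (Local-sym local) m m′ lt
    ... | inj₂ lt′ = inj₂ lt′
    ... | inj₁ (inj₂ m≡k  , inj₁ m′≡i)  = inj₁ (m≡k , m′≡i)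
    ... | inj₁ (inj₁ refl , inj₁ refl)  = contradiction lt (<-irrefl refl)
    ... | inj₁ (inj₂ refl , inj₂ refl)  = contradiction lt (<-irrefl refl)
    ... | inj₁ (inj₁ refl , inj₂ refl)  = contradiction lt (<-asym κ′k<κ′i)

    κ′τi<κ′τk : κ′ (τ i) < κ′ (τ k)
    κ′τi<κ′τk rewrite transpose-left i k | transpose-right i k = κ′k<κ′i

    -- The two pipes of an elbow bounce off each other and keep their order on the frontier, but
    -- each is now recorded in the other row; `τ` undoes this renaming.
    elbow-order : SameOrder κ (κ′ ∘ τ)
    elbow-order m m′ = to , from
      where
      to : κ m < κ m′ → κ′ (τ m) < κ′ (τ m′)
      to lt with Local-order local-τ m m′ lt
      ... | inj₂ lt′ = lt′
      ... | inj₁ (inj₁ refl , inj₂ refl)  = κ′τi<κ′τk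
      ... | inj₁ (inj₁ refl , inj₁ refl)  = contradiction lt (<-irrefl refl)
      ... | inj₁ (inj₂ refl , inj₂ refl)  = contradiction lt (<-irrefl refl)
      ... | inj₁ (inj₂ refl , inj₁ refl)  = contradiction lt (<-asym κi<κk)
      from : κ′ (τ m) < κ′ (τ m′) → κ m < κ m′
      from lt with Local-order (Local-sym local-τ) m m′ lt
      ... | inj₂ lt′ = lt′
      ... | inj₁ (inj₁ refl , inj₂ refl)  = κi<κk
      ... | inj₁ (inj₁ refl , inj₁ refl)  = contradiction lt (<-irrefl refl)
      ... | inj₁ (inj₂ refl , inj₂ refl)  = contradiction lt (<-irrefl refl)
      ... | inj₁ (inj₂ refl , inj₁ refl)  = contradiction lt (<-asym κ′τi<κ′τk)

    κτ≤κ′ : ∀ m → κ (τ m) ≤ κ′ m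
    κτ≤κ′ m with among i k m
    ... | inj₁ (inj₁ refl) rewrite transpose-left i k | κk | κ′i = n≤1+n _
    ... | inj₁ (inj₂ refl) rewrite transpose-right i k | κi | κ′k = n≤1+n _
    ... | inj₂ (m≢i , m≢k) rewrite transpose-other m≢i m≢k = ≤-reflexive (proj₁ (others m≢i m≢k))

    -- Only the ordered pair `(k , i)` changes its contribution, from one to zero. Two applications
    -- of `∑-single` isolate it, first the row `k` and then the column `i` of the matrix of pairs.
    conc-cross : (f : Fin n → ℕ) → f i < f k → conc κ f ≡ suc (conc κ′ f)
    conc-cross f fi<fk = +-cancelʳ-≡ (∑ (pair κ′ k)) _ _ (begin
      conc κ f + ∑ (pair κ′ k)             ≡⟨ ∑-single k (λ m m≢k → ∑-cong (λ m′ → same m m′ (λ { (refl , refl) → m≢k refl }))) ⟩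
      conc κ′ f + ∑ (pair κ k)             ≡⟨ cong (conc κ′ f +_) row ⟩
      conc κ′ f + suc (∑ (pair κ′ k))      ≡⟨ +-suc _ _ ⟩
      suc (conc κ′ f) + ∑ (pair κ′ k)      ∎)
      where
      open ≡-Reasoning
      pair : (Fin n → ℕ) → Fin n → Fin n → ℕ
      pair κ = Conc κ f
      same : ∀ m m′ → ¬ (m ≡ k × m′ ≡ i) → pair κ m m′ ≡ pair κ′ m m′
      same m m′ ≢ki with m Fin.≟ i | m′ Fin.≟ k
      -- For the reversed pair the comparison of keys changes too, but its comparison of values is
      -- false, so it counts zero before and after.
      ... | yes refl | yes refl rewrite <ᵇ-false (<-asym κi<κk) | <ᵇ-false (<-asym fi<fk) with κ′ m′ <ᵇ κ′ m
      ...   | true  = refl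
      ...   | false = refl
      same m m′ ≢ki | yes refl | no m′≢k = cong (λ b → 𝟙 (b ∧ (f m′ <ᵇ f m))) (<ᵇ-cong to from)
        where
        to : κ m′ < κ m → κ′ m′ < κ′ m
        to lt with cross-order m′ m lt
        ... | inj₁ (refl , i≡k) = contradiction i≡k i≢k
        ... | inj₂ lt′ = lt′
        from : κ′ m′ < κ′ m → κ m′ < κ m
        from lt with cross-order⁻¹ m′ m lt
        ... | inj₁ (m′≡k , _) = contradiction m′≡k m′≢k
        ... | inj₂ lt′ = lt′
      same m m′ ≢ki | no m≢i | _ = cong (λ b → 𝟙 (b ∧ (f m′ <ᵇ f m))) (<ᵇ-cong to from)
        where
        to : κ m′ < κ m → κ′ m′ < κ′ m
        to lt with cross-order m′ m lt
        ... | inj₁ (m′≡i , m≡k) = contradiction (m≡k , m′≡i) ≢ki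
        ... | inj₂ lt′ = lt′
        from : κ′ m′ < κ′ m → κ m′ < κ m
        from lt with cross-order⁻¹ m′ m lt
        ... | inj₁ (_ , m≡i) = contradiction m≡i m≢i
        ... | inj₂ lt′ = lt′
      gone : pair κ′ k i ≡ 0
      gone rewrite <ᵇ-false (<-asym κ′k<κ′i) = refl
      there : pair κ k i ≡ 1
      there rewrite <ᵇ-true κi<κk | <ᵇ-true fi<fk = refl
      row : ∑ (pair κ k) ≡ suc (∑ (pair κ′ k))
      row = begin
        ∑ (pair κ k)                       ≡⟨ sym (+-identityʳ _) ⟩
        ∑ (pair κ k) + 0                   ≡⟨ cong (∑ (pair κ k) +_) (sym gone) ⟩
        ∑ (pair κ k) + pair κ′ k i         ≡⟨ ∑-single i (λ m′ m′≢i → same k m′ (m′≢i ∘ proj₂)) ⟩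
        ∑ (pair κ′ k) + pair κ k i         ≡⟨ cong (∑ (pair κ′ k) +_) there ⟩
        ∑ (pair κ′ k) + 1                  ≡⟨ +-comm _ 1 ⟩
        suc (∑ (pair κ′ k))                ∎

    conc-elbow : (f : Fin n → ℕ) → conc κ f ≡ conc κ′ (f ∘ τ)
    conc-elbow f = begin
      conc κ f                         ≡⟨ conc-cong elbow-order f ⟩
      conc (κ′ ∘ τ) f                  ≡⟨ cong-f ⟩
      conc (κ′ ∘ τ) (f ∘ τ ∘ τ)        ≡⟨ sym (conc-transpose i≢k κ′ (f ∘ τ)) ⟩
      conc κ′ (f ∘ τ)                  ∎
      where
      open ≡-Reasoning
      cong-f : conc (κ′ ∘ τ) f ≡ conc (κ′ ∘ τ) (f ∘ τ ∘ τ)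
      cong-f = ∑-cong λ m → ∑-cong λ m′ → cong₂ (λ a b → 𝟙 ((κ′ (τ m′) <ᵇ κ′ (τ m)) ∧ (f a <ᵇ f b)))
        (sym (transpose-involutive i k m′)) (sym (transpose-involutive i k m))

  -- Induction over the boxes

  data Kind (i j : Fin n) (t : Tile) : Set where
    plain : toℕ (u ⟨$⟩ˡ j) ≤ toℕ i ⊎ toℕ j < ⟦ u ⟧ i → (∀ w → act t i (u ⟨$⟩ˡ j) w ≡ w) → elbows t ≡ 0 → Kind i j t
    cross : t ≡ cross → i <ᶠ (u ⟨$⟩ˡ j) → ⟦ u ⟧ i < toℕ j → Kind i j t
    elbow : t ≡ elbow → i <ᶠ (u ⟨$⟩ˡ j) → ⟦ u ⟧ i < toℕ j → Kind i j t

  kind : ∀ {i j t} → Box i j t → Kind i j t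
  kind (pivot i≡k)   = plain (inj₁ (≤-reflexive (cong toℕ (sym i≡k)))) (λ _ → refl) refl
  kind (empty k<i _) = plain (inj₁ (<⇒≤ k<i)) (λ _ → refl) refl
  kind (hor k<i _)   = plain (inj₁ (<⇒≤ k<i)) (λ _ → refl) refl
  kind (vert _ j<u)  = plain (inj₂ j<u) (λ _ → refl) refl
  kind (cross a b)   = cross refl a b
  kind (elbow a b)   = elbow refl a b

  Past : (i j : Fin n) → ℕ → ℕ → Set
  Past i j c d = toℕ i < c ⊎ (toℕ i ≡ c × toℕ j < d)

  Past-step : ∀ {i j : Fin n} (c d : Fin n) → Past i j (toℕ c) (suc (toℕ d)) →
              Past i j (toℕ c) (toℕ d) ⊎ (i ≡ c × j ≡ d)
  Past-step c d (inj₁ i<c) = inj₁ (inj₁ i<c)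
  Past-step c d (inj₂ (i≡c , j≤d)) with m<1+n⇒m<n∨m≡n j≤d
  ... | inj₁ j<d = inj₁ (inj₂ (i≡c , j<d))
  ... | inj₂ j≡d = inj₂ (Fin.toℕ-injective i≡c , Fin.toℕ-injective j≡d)

  Past-next : ∀ {i j : Fin n} {c} → Past i j (suc c) 0 → Past i j c n
  Past-next {j = j} (inj₁ i≤c) with m<1+n⇒m<n∨m≡n i≤c
  ... | inj₁ i<c = inj₁ i<c
  ... | inj₂ i≡c = inj₂ (i≡c , Fin.toℕ<n j)

  Ascending : Tiling n → Fin n → Fin n → Set
  Ascending D i j = i <ᶠ (u ⟨$⟩ˡ j) → ⟦ u ⟧ i < toℕ j → left D i j <ᶠ top D i j

  module _ (D : Tiling n) (box : ∀ i j → Box i j (D i j)) where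

    -- The invariant is stated for a general `w`; the equation with `W D` is handed to the steps,
    -- which match it against `refl` where facts about `left` and `top` are wanted.
    W-induction : (Q : ℕ → ℕ → Permutation′ n → Set) → Q 0 0 u →
      (∀ i j (w : Permutation′ n) → toℕ (u ⟨$⟩ˡ j) ≤ toℕ i ⊎ toℕ j < ⟦ u ⟧ i →
         elbows (D i j) ≡ 0 → w ≡ W D (toℕ i) (toℕ j) → Q (toℕ i) (toℕ j) w → Q (toℕ i) (suc (toℕ j)) w) →
      (∀ i j (w : Permutation′ n) → D i j ≡ cross → i <ᶠ (u ⟨$⟩ˡ j) → ⟦ u ⟧ i < toℕ j →
         w ≡ W D (toℕ i) (toℕ j) → Q (toℕ i) (toℕ j) w → Q (toℕ i) (suc (toℕ j)) w) →
      (∀ i j (w : Permutation′ n) → D i j ≡ elbow → i <ᶠ (u ⟨$⟩ˡ j) → ⟦ u ⟧ i < toℕ j →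
         w ≡ W D (toℕ i) (toℕ j) → Q (toℕ i) (toℕ j) w → Q (toℕ i) (suc (toℕ j)) (transpose i (u ⟨$⟩ˡ j) ∘ₚ w)) →
      (∀ (i : Fin n) (w : Permutation′ n) → Q (toℕ i) n w → Q (suc (toℕ i)) 0 w) →
      Q n 0 (W D n 0) × (∀ (i j : Fin n) → Q (toℕ i) (toℕ j) (W D (toℕ i) (toℕ j)))
    W-induction Q base p c e next =
      sweep-start P base step next′ ≤-refl , λ i j → sweep-box P base step next′ i (<⇒≤ (Fin.toℕ<n j))
      where
      P : ℕ → ℕ → Set
      P i j = Q i j (W D i j)
      next′ : ∀ i → P (toℕ i) n → P (suc (toℕ i)) 0
      next′ i = next i (W D (toℕ i) n)
      step : ∀ i j → P (toℕ i) (toℕ j) → P (toℕ i) (suc (toℕ j))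
      step i j q = subst (Q (toℕ i) (suc (toℕ j))) (sym (W-step D i j)) (by-kind (kind (box i j)))
        where
        w = W D (toℕ i) (toℕ j)
        by-kind : Kind i j (D i j) → Q (toℕ i) (suc (toℕ j)) (act (D i j) i (u ⟨$⟩ˡ j) w)
        by-kind (plain h same el) rewrite same w = p i j w h el refl q
        by-kind (cross eq a b) = subst (λ t → Q (toℕ i) (suc (toℕ j)) (act t i (u ⟨$⟩ˡ j) w)) (sym eq) (c i j w eq a b refl q)
        by-kind (elbow eq a b) = subst (λ t → Q (toℕ i) (suc (toℕ j)) (act t i (u ⟨$⟩ˡ j) w)) (sym eq) (e i j w eq a b refl q)

    -- Ascending tilings: Bruhat chain and length

    module _ (asc : ∀ i j → Ascending D i j) where

      ascending⇒≤B : u ≤B W D n 0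
      ascending⇒≤B = proj₁ (W-induction (λ _ _ w → u ≤B w) (≤B-refl (λ _ → refl))
        (λ _ _ _ _ _ _ q → q) (λ _ _ _ _ _ _ _ q → q)
        (λ { i j w _ i<k u<j refl q → ≤B-snoc q (BruhatStep-transpose w i<k (asc i j i<k u<j)) })
        (λ _ _ q → q))

      elbowsRead : ℕ → ℕ → ℕ
      elbowsRead = Sweep.before (λ i j x → x + elbows (D i j)) 0

      elbowsRead-step : ∀ i j → elbowsRead (toℕ i) (suc (toℕ j)) ≡ elbowsRead (toℕ i) (toℕ j) + elbows (D i j)
      elbowsRead-step = Sweep.before-step (λ i j x → x + elbows (D i j)) 0

      elbowsRead-end : elbowsRead n 0 ≡ ∑ λ i → ∑ λ j → elbows (D i j)
      elbowsRead-end = ∑-telescope (λ i → ∑ λ j → elbows (D i j)) (λ i → elbowsRead i 0)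
        (λ i → ∑-telescope (λ j → elbows (D i j)) (elbowsRead (toℕ i)) (elbowsRead-step i))

      -- Every cross read destroys one concordant pair of W and one of u, every elbow destroys one
      -- of u only.
      concordance : conc (key n 0) ⟦ W D n 0 ⟧ ≡ conc (key n 0) ⟦ u ⟧ + elbowsRead n 0
      concordance = proj₁ (W-induction Q (sym (+-identityʳ _)) still-step cross-step elbow-step
        (λ i w q → transport (next-row i) w q))
        where
        open ≡-Reasoning
        Q : ℕ → ℕ → Permutation′ n → Set
        Q i j w = conc (key i j) ⟦ w ⟧ ≡ conc (key i j) ⟦ u ⟧ + elbowsRead i j
        transport : ∀ {κ κ′ e} → SameOrder κ κ′ → ∀ w → conc κ ⟦ w ⟧ ≡ conc κ ⟦ u ⟧ + e → conc κ′ ⟦ w ⟧ ≡ conc κ′ ⟦ u ⟧ + e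
        transport same w = subst₂ (λ a b → a ≡ b + _) (conc-cong same ⟦ w ⟧) (conc-cong same ⟦ u ⟧)
        still-step : ∀ i j w → _ → elbows (D i j) ≡ 0 → w ≡ W D (toℕ i) (toℕ j) → Q (toℕ i) (toℕ j) w → Q (toℕ i) (suc (toℕ j)) w
        still-step i j w h el _ q rewrite elbowsRead-step i j | el | +-identityʳ (elbowsRead (toℕ i) (toℕ j)) =
          transport (still i j h) w q
        cross-step : ∀ i j w → D i j ≡ cross → i <ᶠ (u ⟨$⟩ˡ j) → ⟦ u ⟧ i < toℕ j → w ≡ W D (toℕ i) (toℕ j) →
                     Q (toℕ i) (toℕ j) w → Q (toℕ i) (suc (toℕ j)) w
        cross-step i j w eq i<k u<j refl q
          rewrite elbowsRead-step i j | eq | +-identityʳ (elbowsRead (toℕ i) (toℕ j)) = suc-injective (begin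
            suc (conc (key (toℕ i) (suc (toℕ j))) ⟦ w ⟧)    ≡⟨ sym (conc-cross ⟦ w ⟧ (asc i j i<k u<j)) ⟩
            conc (key (toℕ i) (toℕ j)) ⟦ w ⟧                ≡⟨ q ⟩
            conc (key (toℕ i) (toℕ j)) ⟦ u ⟧ + elbowsRead (toℕ i) (toℕ j)
              ≡⟨ cong (_+ elbowsRead (toℕ i) (toℕ j)) (conc-cross ⟦ u ⟧ (subst (⟦ u ⟧ i <_) (sym (column j)) u<j)) ⟩
            suc (conc (key (toℕ i) (suc (toℕ j))) ⟦ u ⟧ + elbowsRead (toℕ i) (toℕ j))  ∎)
          where open Crossing i j i<k u<j
        elbow-step : ∀ i j w → D i j ≡ elbow → i <ᶠ (u ⟨$⟩ˡ j) → ⟦ u ⟧ i < toℕ j → w ≡ W D (toℕ i) (toℕ j) →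
                     Q (toℕ i) (toℕ j) w → Q (toℕ i) (suc (toℕ j)) (transpose i (u ⟨$⟩ˡ j) ∘ₚ w)
        elbow-step i j w eq i<k u<j refl q
          rewrite elbowsRead-step i j | eq = begin
            conc (key (toℕ i) (suc (toℕ j))) (⟦ w ⟧ ∘ (transpose i (u ⟨$⟩ˡ j) ⟨$⟩ʳ_))  ≡⟨ sym (conc-elbow ⟦ w ⟧) ⟩
            conc (key (toℕ i) (toℕ j)) ⟦ w ⟧                ≡⟨ q ⟩
            conc (key (toℕ i) (toℕ j)) ⟦ u ⟧ + elbowsRead (toℕ i) (toℕ j)
              ≡⟨ cong (_+ elbowsRead (toℕ i) (toℕ j)) (conc-cross ⟦ u ⟧ (subst (⟦ u ⟧ i <_) (sym (column j)) u<j)) ⟩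
            suc (conc (key (toℕ i) (suc (toℕ j))) ⟦ u ⟧ + elbowsRead (toℕ i) (toℕ j))  ≡⟨ sym (+-suc _ _) ⟩
            conc (key (toℕ i) (suc (toℕ j))) ⟦ u ⟧ + suc (elbowsRead (toℕ i) (toℕ j))
              ≡⟨ cong (conc (key (toℕ i) (suc (toℕ j))) ⟦ u ⟧ +_) (+-comm 1 _) ⟩
            conc (key (toℕ i) (suc (toℕ j))) ⟦ u ⟧ + (elbowsRead (toℕ i) (toℕ j) + 1)  ∎
          where open Crossing i j i<k u<j

      ℓ-conc : ∀ w → ℓ w ≡ conc (key n 0) ⟦ w ⟧
      ℓ-conc w = ∑-cong {f = λ m → ∑ (Inv ⟦ w ⟧ m)} {λ m → ∑ (Conc (key n 0) ⟦ w ⟧ m)} λ m →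
        ∑-cong {f = Inv ⟦ w ⟧ m} {Conc (key n 0) ⟦ w ⟧ m} λ m′ →
          cong (λ b → 𝟙 (b ∧ (⟦ w ⟧ m′ <ᵇ ⟦ w ⟧ m))) (<ᵇ-cong (proj₁ (key-end m m′)) (proj₂ (key-end m m′)))

      ascending⇒length : ℓ (W D n 0) ≡ ℓ u + elbowCount D
      ascending⇒length = begin
        ℓ (W D n 0)                                        ≡⟨ ℓ-conc (W D n 0) ⟩
        conc (key n 0) ⟦ W D n 0 ⟧                         ≡⟨ concordance ⟩
        conc (key n 0) ⟦ u ⟧ + elbowsRead n 0              ≡⟨ cong₂ _+_ (sym (ℓ-conc u)) elbowsRead-end ⟩
        ℓ u + (∑ λ i → ∑ λ j → elbows (D i j))             ≡⟨ cong (ℓ u +_) (sym (elbowCount-∑ D)) ⟩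
        ℓ u + elbowCount D                                 ∎
        where open ≡-Reasoning

      -- Pipes of an ascending tiling part after crossing

      SouthwestOf : Fin n → Fin n → ℕ → ℕ → Permutation′ n → Set
      SouthwestOf p q i j w = Σ (Fin n) λ m → Σ (Fin n) λ m′ →
        key i j m < key i j m′ × w ⟨$⟩ʳ m ≡ p × w ⟨$⟩ʳ m′ ≡ q

      module _ (i j : Fin n) (eq : D i j ≡ cross) (i<k : i <ᶠ (u ⟨$⟩ˡ j)) (u<j : ⟦ u ⟧ i < toℕ j) where

        private
          p = top D i j
          q = left D i j

        -- The cross at `(i , j)` brings the pipe `p` from the top to the southwest of `q`, which
        -- has the smaller label. Only a later cross of the same two could undo this; there `p`
        -- would come from the left, and `asc` would make `p` the smaller label. Elbows preserve the
        -- order of the pipes.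
        stays-southwest : ∀ c d → Past i j (toℕ c) (toℕ d) → SouthwestOf p q (toℕ c) (toℕ d) (W D (toℕ c) (toℕ d))
        stays-southwest = proj₂ (W-induction Q (λ { (inj₁ ()) ; (inj₂ (_ , ())) }) still-step cross-step elbow-step next-step)
          where
          Q : ℕ → ℕ → Permutation′ n → Set
          Q c d w = Past i j c d → SouthwestOf p q c d w
          transport : ∀ c d c′ d′ w → SameOrder (key c d) (key c′ d′) → SouthwestOf p q c d w → SouthwestOf p q c′ d′ w
          transport c d c′ d′ w same (m , m′ , lt , e , e′) = m , m′ , proj₁ (same m m′) lt , e , e′
          next-step : ∀ c w → Q (toℕ c) n w → Q (suc (toℕ c)) 0 w
          next-step c w h past = transport (toℕ c) n (suc (toℕ c)) 0 w (next-row c) (h (Past-next past))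
          still-step : ∀ c d w → toℕ (u ⟨$⟩ˡ d) ≤ toℕ c ⊎ toℕ d < ⟦ u ⟧ c → elbows (D c d) ≡ 0 →
                       w ≡ W D (toℕ c) (toℕ d) → Q (toℕ c) (toℕ d) w → Q (toℕ c) (suc (toℕ d)) w
          still-step c d w free el eqw h past with Past-step c d past
          ... | inj₁ past′ = transport (toℕ c) (toℕ d) (toℕ c) (suc (toℕ d)) w (still c d free) (h past′)
          still-step c d w (inj₁ k≤i) el eqw h past | inj₂ (refl , refl) = contradiction i<k (≤⇒≯ k≤i)
          still-step c d w (inj₂ j<u) el eqw h past | inj₂ (refl , refl) = contradiction u<j (<-asym j<u)
          cross-step : ∀ c d w → D c d ≡ cross → c <ᶠ (u ⟨$⟩ˡ d) → ⟦ u ⟧ c < toℕ d → w ≡ W D (toℕ c) (toℕ d) →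
                       Q (toℕ c) (toℕ d) w → Q (toℕ c) (suc (toℕ d)) w
          cross-step c d w _ c<k u<d refl h past with Past-step c d past
          ... | inj₂ (refl , refl) = u ⟨$⟩ˡ d , c , Crossing.κ′k<κ′i c d c<k u<d , refl , refl
          ... | inj₁ past′ with h past′
          ...   | m , m′ , lt , e , e′ with Crossing.cross-order c d c<k u<d m m′ lt
          ...     | inj₂ lt′ = m , m′ , lt′ , e , e′
          ...     | inj₁ (refl , refl) =
                    contradiction (subst₂ _<ᶠ_ e e′ (asc c d c<k u<d)) (<-asym (asc i j i<k u<j))
          elbow-step : ∀ c d w → D c d ≡ elbow → c <ᶠ (u ⟨$⟩ˡ d) → ⟦ u ⟧ c < toℕ d → w ≡ W D (toℕ c) (toℕ d) →
                       Q (toℕ c) (toℕ d) w → Q (toℕ c) (suc (toℕ d)) (transpose c (u ⟨$⟩ˡ d) ∘ₚ w)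
          elbow-step c d w eq′ c<k u<d refl h past with Past-step c d past
          ... | inj₂ (refl , refl) = contradiction (trans (sym eq) eq′) λ ()
          ... | inj₁ past′ with h past′
          ...   | m , m′ , lt , e , e′ = τ m , τ m′ , proj₁ (Crossing.elbow-order c d c<k u<d m m′) lt ,
                    trans (cong (w ⟨$⟩ʳ_) (transpose-involutive c (u ⟨$⟩ˡ d) m)) e ,
                    trans (cong (w ⟨$⟩ʳ_) (transpose-involutive c (u ⟨$⟩ˡ d) m′)) e′
            where τ = transpose c (u ⟨$⟩ˡ d) ⟨$⟩ʳ_

        -- A pipe entering a box from the left is southwest of the one entering from the top, so
        -- such a meeting contradicts `stays-southwest`.
        never-meet-again : ∀ c d → Past i j (toℕ c) (toℕ d) → c <ᶠ (u ⟨$⟩ˡ d) → ⟦ u ⟧ c < toℕ d →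
                           ¬ (left D c d ≡ q × top D c d ≡ p)
        never-meet-again c d past c<k u<d (e₁ , e₂) with stays-southwest c d past
        ... | m , m′ , lt , e , e′
          with refl ← ⟨$⟩ʳ-injective (W D (toℕ c) (toℕ d)) (trans e (sym e₂))
             | refl ← ⟨$⟩ʳ-injective (W D (toℕ c) (toℕ d)) (trans e′ (sym e₁)) =
          <-asym lt (Crossing.κi<κk c d c<k u<d)

    open Trace D box

    crossable : ∀ {i j} → D i j ≡ cross ⊎ D i j ≡ elbow → i <ᶠ (u ⟨$⟩ˡ j) × ⟦ u ⟧ i < toℕ j
    crossable {i} {j} (inj₁ eq) with subst (Box i j) eq (box i j)
    ... | cross i<k u<j = i<k , u<j
    crossable {i} {j} (inj₂ eq) with subst (Box i j) eq (box i j)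
    ... | elbow i<k u<j = i<k , u<j

    Labels : Fin n → Fin n → Fin n → Fin n → Set
    Labels i j p q = (p ≡ left D i j ⊎ p ≡ top D i j) × (q ≡ left D i j ⊎ q ≡ top D i j)

    labels : ∀ {b p q} → b ∈ boxesOf D p → b ∈ boxesOf D q →
             Σ (Fin n) λ i → Σ (Fin n) λ j → b ≡ (toℕ i , toℕ j) × Labels i j p q
    labels b∈p b∈q with labelled b∈p | labelled b∈q
    ... | i , j , refl , lp | i′ , j′ , eq , lq
      with refl ← Fin.toℕ-injective (proj₁ (,-injective eq)) | refl ← Fin.toℕ-injective (proj₂ (,-injective eq)) =
      i , j , refl , lp , lq

    module _ (asc : ∀ i j → Ascending D i j) where

      left-top : ∀ {i j p q} → i <ᶠ (u ⟨$⟩ˡ j) → ⟦ u ⟧ i < toℕ j → Labels i j p q → p <ᶠ q →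
                 left D i j ≡ p × top D i j ≡ q
      left-top i<k u<j (inj₁ refl , inj₁ refl) p<q = contradiction p<q (<-irrefl refl)
      left-top i<k u<j (inj₂ refl , inj₂ refl) p<q = contradiction p<q (<-irrefl refl)
      left-top i<k u<j (inj₁ refl , inj₂ refl) p<q = refl , refl
      left-top i<k u<j (inj₂ refl , inj₁ refl) p<q = contradiction p<q (<-asym (asc _ _ i<k u<j))

      -- By `asc` the pipe with the smaller label comes from the left at every meeting, so a second
      -- meeting would repeat the sides of the first, which `never-meet-again` excludes.
      cross-then-apart : ∀ {i j c d p q} → D i j ≡ cross → D c d ≡ cross ⊎ D c d ≡ elbow → Past i j (toℕ c) (toℕ d) →
                         p ≢ q → Labels i j p q → ¬ Labels c d p q
      cross-then-apart {i} {j} {c} {d} {p} {q} eq eq′ past p≢q (lp , lq) (lp′ , lq′) with <-cmp (toℕ p) (toℕ q)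
      ... | tri≈ _ p≡q _ = p≢q (Fin.toℕ-injective p≡q)
      ... | tri< p<q _ _
        with i<k , u<j ← crossable (inj₁ eq) | c<k , u<d ← crossable eq′
        with e₁ , e₂ ← left-top i<k u<j (lp , lq) p<q | e₁′ , e₂′ ← left-top c<k u<d (lp′ , lq′) p<q =
        never-meet-again asc i j eq i<k u<j c d past c<k u<d (trans e₁′ (sym e₁) , trans e₂′ (sym e₂))
      ... | tri> _ _ q<p
        with i<k , u<j ← crossable (inj₁ eq) | c<k , u<d ← crossable eq′
        with e₁ , e₂ ← left-top i<k u<j (lq , lp) q<p | e₁′ , e₂′ ← left-top c<k u<d (lq′ , lp′) q<p =
        never-meet-again asc i j eq i<k u<j c d past c<k u<d (trans e₁′ (sym e₁) , trans e₂′ (sym e₂))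

      ascending⇒IsReduced : IsReduced D
      ascending⇒IsReduced p q p≢q b c (tb , pb , qb) (tc , pc , qc) with labels pb qb | labels pc qc
      ... | i , j , refl , lb | i′ , j′ , refl , lc = same (<-cmp (toℕ i) (toℕ i′)) (<-cmp (toℕ j) (toℕ j′))
        where
        eq : D i j ≡ cross
        eq = trans (sym (tileAt-toℕ D i j)) tb
        eq′ : D i′ j′ ≡ cross
        eq′ = trans (sym (tileAt-toℕ D i′ j′)) tc
        forward : ¬ Past i j (toℕ i′) (toℕ j′)
        forward past = cross-then-apart eq (inj₁ eq′) past p≢q lb lc
        backward : ¬ Past i′ j′ (toℕ i) (toℕ j)
        backward past = cross-then-apart eq′ (inj₁ eq) past p≢q lc lb
        same : Tri (toℕ i < toℕ i′) (toℕ i ≡ toℕ i′) (toℕ i′ < toℕ i) → Tri (toℕ j < toℕ j′) (toℕ j ≡ toℕ j′) (toℕ j′ < toℕ j) →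
               (toℕ i , toℕ j) ≡ (toℕ i′ , toℕ j′)
        same (tri< i<i′ _ _) _ = contradiction (inj₁ i<i′) forward
        same (tri> _ _ i′<i) _ = contradiction (inj₁ i′<i) backward
        same (tri≈ _ i≡i′ _) (tri< j<j′ _ _) = contradiction (inj₂ (i≡i′ , j<j′)) forward
        same (tri≈ _ i≡i′ _) (tri> _ _ j′<j) = contradiction (inj₂ (sym i≡i′ , j′<j)) backward
        same (tri≈ _ i≡i′ _) (tri≈ _ j≡j′ _) = cong₂ _,_ i≡i′ j≡j′

      ascending⇒NoTouchAfterCross : NoTouchAfterCross D
      ascending⇒NoTouchAfterCross p q p≢q a b c d (tb , pb , qb) a<c b<d (tc , pc , qc) with labels pb qb | labels pc qc
      ... | i , j , refl , lb | i′ , j′ , refl , lc =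
        cross-then-apart (trans (sym (tileAt-toℕ D i j)) tb) (inj₂ (trans (sym (tileAt-toℕ D i′ j′)) tc)) (inj₁ a<c) p≢q lb lc

      ascending⇒IsFPP : {v : Permutation′ n} → (∀ m → W D n 0 ⟨$⟩ʳ m ≡ v ⟨$⟩ʳ m) → IsFPP u v D
      ascending⇒IsFPP {v} e =
        Box⇒IsRothe box , (λ p → _ , trans (cong (exitOf D) (sym (inverseʳ (W D n 0)))) (exit _)) ,
        ascending⇒IsReduced , (λ m → trans (cong (exitOf D) (sym (e m))) (exit m)) , ascending⇒NoTouchAfterCross

    -- Flag positroid pipe dreams are ascending

    exit-permutation : {v : Permutation′ n} → HasExitPerm D v → ∀ m → W D n 0 ⟨$⟩ʳ m ≡ v ⟨$⟩ʳ m
    exit-permutation {v} h m = begin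
      W D n 0 ⟨$⟩ʳ m                       ≡⟨ cong (W D n 0 ⟨$⟩ʳ_) (sym row) ⟩
      W D n 0 ⟨$⟩ʳ (W D n 0 ⟨$⟩ˡ (v ⟨$⟩ʳ m))  ≡⟨ inverseʳ (W D n 0) ⟩
      v ⟨$⟩ʳ m                             ∎
      where
      open ≡-Reasoning
      exitRight-injective : ∀ {a b} → exitRight a ≡ exitRight b → a ≡ b
      exitRight-injective refl = refl
      row : W D n 0 ⟨$⟩ˡ (v ⟨$⟩ʳ m) ≡ m
      row = Fin.toℕ-injective (exitRight-injective
        (trans (sym (exit _)) (trans (cong (exitOf D) (inverseʳ (W D n 0))) (h m))))

    -- The last two components ensure that a later meeting of the pipes is strictly southeast of the
    -- cross: `m′` is at or beyond the right edge of column `b`, and the cross is above row `i` or,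
    -- if in row `i`, the pipe of `m` has already passed on below.
    Crossed : (i j : ℕ) (m m′ p q : Fin n) → Set
    Crossed i j m m′ p q = Σ (Fin n) λ a → Σ (Fin n) λ b →
      D a b ≡ cross × (toℕ a , toℕ b) ∈ boxesOf D p × (toℕ a , toℕ b) ∈ boxesOf D q ×
      dbl (suc (toℕ b)) ≤ key i j m′ × (toℕ a < i ⊎ (toℕ a ≡ i × i < toℕ m × ⟦ u ⟧ m < j))

    -- Initially keys and labels are in the same order. An elbow keeps every pair of pipes in its
    -- order on the frontier; a cross reverses only its own two pipes, and is then itself the
    -- witness.
    inverted⇒crossed : ∀ i j m m′ → key (toℕ i) (toℕ j) m < key (toℕ i) (toℕ j) m′ →
      ⟦ W D (toℕ i) (toℕ j) ⟧ m′ < ⟦ W D (toℕ i) (toℕ j) ⟧ m →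
      Crossed (toℕ i) (toℕ j) m m′ (W D (toℕ i) (toℕ j) ⟨$⟩ʳ m) (W D (toℕ i) (toℕ j) ⟨$⟩ʳ m′)
    inverted⇒crossed = proj₂ (W-induction Q start still-step cross-step elbow-step next-step)
      where
      Q : ℕ → ℕ → Permutation′ n → Set
      Q i j w = ∀ m m′ → key i j m < key i j m′ → ⟦ w ⟧ m′ < ⟦ w ⟧ m → Crossed i j m m′ (w ⟨$⟩ʳ m) (w ⟨$⟩ʳ m′)
      start : Q 0 0 u
      start m m′ lt lt′ rewrite key-start m | key-start m′ = contradiction (dbl-mono (<⇒≤ lt′)) (<⇒≱ (≤-pred lt))
      later : ∀ i j m m′ {p q} → Crossed (toℕ i) (toℕ j) m m′ p q → Crossed (toℕ i) (suc (toℕ j)) m m′ p q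
      later i j m m′ (a , b , eq , p∈ , q∈ , le , inj₁ a<i) =
        a , b , eq , p∈ , q∈ , ≤-trans le (key-mono i j m′) , inj₁ a<i
      later i j m m′ (a , b , eq , p∈ , q∈ , le , inj₂ (a≡i , i<m , u<j)) =
        a , b , eq , p∈ , q∈ , ≤-trans le (key-mono i j m′) , inj₂ (a≡i , i<m , m<n⇒m<1+n u<j)
      next-step : ∀ (i : Fin n) w → Q (toℕ i) n w → Q (suc (toℕ i)) 0 w
      next-step i w q m m′ lt lt′ with q m m′ (proj₂ (next-row i m m′) lt) lt′
      ... | a , b , eq , p∈ , q∈ , le , pos = a , b , eq , p∈ , q∈ , ≤-trans le (key-mono-row i m′) , inj₁ (bound pos)
        where
        bound : toℕ a < toℕ i ⊎ (toℕ a ≡ toℕ i × _) → toℕ a < suc (toℕ i)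
        bound (inj₁ a<i)       = m<n⇒m<1+n a<i
        bound (inj₂ (a≡i , _)) = s≤s (≤-reflexive a≡i)
      still-step : ∀ i j w → toℕ (u ⟨$⟩ˡ j) ≤ toℕ i ⊎ toℕ j < ⟦ u ⟧ i → elbows (D i j) ≡ 0 →
                   w ≡ W D (toℕ i) (toℕ j) → Q (toℕ i) (toℕ j) w → Q (toℕ i) (suc (toℕ j)) w
      still-step i j w h _ _ q m m′ lt lt′ = later i j m m′ (q m m′ (proj₂ (still i j h m m′) lt) lt′)
      cross-step : ∀ i j w → D i j ≡ cross → i <ᶠ (u ⟨$⟩ˡ j) → ⟦ u ⟧ i < toℕ j → w ≡ W D (toℕ i) (toℕ j) →
                   Q (toℕ i) (toℕ j) w → Q (toℕ i) (suc (toℕ j)) w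
      cross-step i j w eq i<k u<j refl q m m′ lt lt′ with Crossing.cross-order⁻¹ i j i<k u<j m m′ lt
      ... | inj₂ lt″ = later i j m m′ (q m m′ lt″ lt′)
      ... | inj₁ (refl , refl) =
        i , j , eq , proj₂ (meet (inj₁ eq) i<k u<j) , proj₁ (meet (inj₁ eq) i<k u<j) ,
        ≤-reflexive (sym (Crossing.κ′i i j i<k u<j)) ,
        inj₂ (refl , i<k , subst (_< suc (toℕ j)) (sym (column j)) (n<1+n _))
      elbow-step : ∀ i j w → D i j ≡ elbow → i <ᶠ (u ⟨$⟩ˡ j) → ⟦ u ⟧ i < toℕ j → w ≡ W D (toℕ i) (toℕ j) →
                   Q (toℕ i) (toℕ j) w → Q (toℕ i) (suc (toℕ j)) (transpose i (u ⟨$⟩ˡ j) ∘ₚ w)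
      elbow-step i j w eq i<k u<j refl q m m′ lt lt′
        with q (τ m) (τ m′) (proj₂ (Crossing.elbow-order i j i<k u<j (τ m) (τ m′)) (subst₂ (λ a b → key′ a < key′ b) (sym (ττ m)) (sym (ττ m′)) lt)) lt′
        where
        τ = transpose i (u ⟨$⟩ˡ j) ⟨$⟩ʳ_
        ττ = transpose-involutive i (u ⟨$⟩ˡ j)
        key′ = key (toℕ i) (suc (toℕ j))
      ... | a , b , eq′ , p∈ , q∈ , le , pos =
        a , b , eq′ , p∈ , q∈ , ≤-trans le (Crossing.κτ≤κ′ i j i<k u<j m′) , position pos
        where
        τ = transpose i (u ⟨$⟩ˡ j) ⟨$⟩ʳ_
        position : toℕ a < toℕ i ⊎ (toℕ a ≡ toℕ i × toℕ i < toℕ (τ m) × ⟦ u ⟧ (τ m) < toℕ j) →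
                   toℕ a < toℕ i ⊎ (toℕ a ≡ toℕ i × toℕ i < toℕ m × ⟦ u ⟧ m < suc (toℕ j))
        position (inj₁ a<i) = inj₁ a<i
        -- This alternative survives only for the other rows: for `m` equal to `i` the column of
        -- `τ m` is `j` itself, and for `u ⟨$⟩ˡ j` the row `τ m` is `i`.
        position (inj₂ (a≡i , i<τm , uτm<j)) with among i (u ⟨$⟩ˡ j) m
        ... | inj₁ (inj₁ refl) rewrite transpose-left i (u ⟨$⟩ˡ j) = contradiction uτm<j (<-irrefl (column j))
        ... | inj₁ (inj₂ refl) rewrite transpose-right i (u ⟨$⟩ˡ j) = contradiction i<τm (<-irrefl refl)
        ... | inj₂ (m≢i , m≢k) rewrite transpose-other m≢i m≢k = inj₂ (a≡i , i<τm , m<n⇒m<1+n uτm<j)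

    -- If the larger label came from the left, the pair would be inverted on the frontier, and the
    -- pipes would have crossed strictly northwest of the box. Then `reduced` forbids a cross here
    -- and `noTouch` an elbow.
    IsFPP⇒ascending : IsReduced D → NoTouchAfterCross D → ∀ i j → Ascending D i j
    IsFPP⇒ascending reduced noTouch i j i<k u<j with <-cmp (toℕ (left D i j)) (toℕ (top D i j))
    ... | tri< l<t _ _ = l<t
    ... | tri≈ _ l≡t _ = contradiction (⟦⟧-injective (W D (toℕ i) (toℕ j)) l≡t) (Crossing.i≢k i j i<k u<j)
    ... | tri> _ l≢t t<l with inverted⇒crossed i j i (u ⟨$⟩ˡ j) (Crossing.κi<κk i j i<k u<j) t<l
    ...   | a , b , eq , p∈ , q∈ , le , inj₂ (_ , i<i , _) = contradiction i<i (<-irrefl refl)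
    ...   | a , b , eq , p∈ , q∈ , le , inj₁ a<i = contradiction (box i j) impossible
      where
      p≢q : left D i j ≢ top D i j
      p≢q e = l≢t (cong toℕ e)
      crossing : CrossAt D (left D i j) (top D i j) (toℕ a , toℕ b)
      crossing = trans (tileAt-toℕ D a b) eq , p∈ , q∈
      b<j : toℕ b < toℕ j
      -- The top edge of column `j` has key `1 + 2j`, for which the cross provides the lower bound
      -- `2(b + 1)`.
      b<j = ≰⇒> λ j≤b → <⇒≱ (≤-pred (subst (dbl (suc (toℕ b)) ≤_) (Crossing.κk i j i<k u<j) le)) (dbl-mono j≤b)
      no-cross : D i j ≢ cross
      no-cross eq′ = <⇒≢ a<i (proj₁ (,-injective (reduced (left D i j) (top D i j) p≢q (toℕ a , toℕ b) (toℕ i , toℕ j) crossing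
        (trans (tileAt-toℕ D i j) eq′ , meet (inj₁ eq′) i<k u<j))))
      no-elbow : D i j ≢ elbow
      no-elbow eq′ = noTouch (left D i j) (top D i j) p≢q (toℕ a) (toℕ b) (toℕ i) (toℕ j) crossing a<i b<j
        (trans (tileAt-toℕ D i j) eq′ , meet (inj₂ eq′) i<k u<j)
      impossible : ¬ Box i j (D i j)
      impossible bx with kind bx
      ... | cross eq′ _ _ = no-cross eq′
      ... | elbow eq′ _ _ = no-elbow eq′
      ... | plain (inj₁ k≤i) _ _ = <⇒≱ i<k k≤i
      ... | plain (inj₂ j<u) _ _ = <-asym u<j j<u

  -- Reconstruction of a tiling from the rank inequalities

  start-unique : (x : Permutation′ n) → Dominates (key 0 0) ⟦ x ⟧ ⟦ u ⟧ → ∀ m → u ⟨$⟩ʳ m ≡ x ⟨$⟩ʳ m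
  start-unique x dom = ≤⇒≡ u x λ m → ≤-pred (bound m)
    where
    bound : ∀ m → ⟦ x ⟧ m < suc (⟦ u ⟧ m)
    bound m₀ = <ᵇ-true⁻¹ _ _ (positive (∑-squeeze {f = f} {g} f≤g (dom P lower b) m₀))
      where
      b : ℕ
      b = suc (⟦ u ⟧ m₀)
      -- On this set all labels of `u` are below `b`, so `f` is termwise at most `g`; the rank
      -- inequality gives the reverse for the sums, and `∑-squeeze` the equality at `m₀`.
      P : Fin n → Bool
      P m = ⟦ u ⟧ m <ᵇ b
      f g : Fin n → ℕ
      f m = 𝟙 (P m ∧ (⟦ x ⟧ m <ᵇ b))
      g m = 𝟙 (P m ∧ (⟦ u ⟧ m <ᵇ b))
      lower : Lower (key 0 0) P
      lower m m′ lt Pm′ rewrite key-start m | key-start m′ =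
        <ᵇ-true (<-trans (≰⇒> (λ le → <⇒≱ (≤-pred lt) (dbl-mono le))) (<ᵇ-true⁻¹ (⟦ u ⟧ m′) b Pm′))
      f≤g : ∀ m → f m ≤ g m
      f≤g m with ⟦ u ⟧ m <ᵇ b
      ... | true  = 𝟙≤1 _
      ... | false = z≤n
      positive : g m₀ ≤ f m₀ → (⟦ x ⟧ m₀ <ᵇ b) ≡ true
      positive h rewrite <ᵇ-true (n<1+n (⟦ u ⟧ m₀)) with ⟦ x ⟧ m₀ <ᵇ b
      ... | true = refl

  ≤B⇒Dominates : {v : Permutation′ n} → u ≤B v → Dominates (key n 0) ⟦ v ⟧ ⟦ u ⟧
  ≤B⇒Dominates u≤v P lower b = ≤B⇒count P (λ m m′ m<m′ → lower m′ m (proj₁ (key-end m m′) m<m′)) b u≤v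

  module _ (i j : Fin n) (i<k : i <ᶠ (u ⟨$⟩ˡ j)) (u<j : ⟦ u ⟧ i < toℕ j) where

    open Crossing i j i<k u<j

    private
      k = u ⟨$⟩ˡ j
      κ κ′ : Fin n → ℕ
      κ  = key (toℕ i) (toℕ j)
      κ′ = key (toℕ i) (suc (toℕ j))

    lower-both : {P : Fin n → Bool} → P i ≡ P k → Lower κ P → Lower κ′ P
    lower-both Pi≡Pk lower m m′ lt Pm′ with cross-order⁻¹ m m′ lt
    ... | inj₁ (refl , refl) = trans (sym Pi≡Pk) Pm′
    ... | inj₂ lt′ = lower m m′ lt′ Pm′

    module _ {P : Fin n → Bool} (Pi : P i ≡ true) (Pk : P k ≡ false) (lower : Lower κ P) where

      private
        P⁻ P⁺ : Fin n → Bool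
        P⁻ = P [ i ≔ false ]
        P⁺ = P [ k ≔ true ]

      P⁻k : P⁻ k ≡ false
      P⁻k = trans (≔-off P false (i≢k ∘ sym)) Pk

      P⁺i : P⁺ i ≡ true
      P⁺i = trans (≔-off P true i≢k) Pi

      -- As `P` contains `i` but not `k`, it stops being lower when the two are exchanged. They are
      -- adjacent on the frontier, so removing `i`, or adding `k` as in `lower-insert`, is enough to
      -- repair it.
      lower-remove : Lower κ′ P⁻
      lower-remove m m′ lt P⁻m′ with m′ Fin.≟ i
      ... | no m′≢i with m Fin.≟ i
      ...   | no _ with cross-order⁻¹ m m′ lt
      ...     | inj₁ (_ , m′≡i) = contradiction m′≡i m′≢i
      ...     | inj₂ lt′ = lower m m′ lt′ P⁻m′
      lower-remove m m′ lt P⁻m′ | no m′≢i | yes refl with cross-order⁻¹ k m′ (<-trans κ′k<κ′i lt)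
      ... | inj₁ (_ , m′≡i) = contradiction m′≡i m′≢i
      ... | inj₂ lt′ = contradiction (trans (sym Pk) (lower k m′ lt′ P⁻m′)) λ ()

      lower-insert : Lower κ′ P⁺
      lower-insert m m′ lt P⁺m′ with m Fin.≟ k
      ... | yes _ = refl
      ... | no m≢k with m′ Fin.≟ k
      ...   | yes refl with cross-order⁻¹ m i (<-trans lt κ′k<κ′i)
      ...     | inj₁ (m≡k , _) = contradiction m≡k m≢k
      ...     | inj₂ lt′ = lower m i lt′ Pi
      lower-insert m m′ lt P⁺m′ | no m≢k | no _ with cross-order⁻¹ m m′ lt
      ... | inj₁ (m≡k , _) = contradiction m≡k m≢k
      ... | inj₂ lt′ = lower m m′ lt′ P⁺m′

    -- Sorting the labels of the two exchanged rows can only increase the counts over lower sets.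
    Dominates-sort : {x x′ : Fin n → ℕ} → (∀ m → m ≢ i → m ≢ k → x′ m ≡ x m) →
                     (x′ i ≡ x i × x′ k ≡ x k) ⊎ (x′ i ≡ x k × x′ k ≡ x i) → x′ i < x′ k →
                     Dominates κ′ x ⟦ u ⟧ → Dominates κ x′ ⟦ u ⟧
    Dominates-sort {x} {x′} off on asc dom P lower b = by-cases (P i) (P k) refl refl
      where
      open ≤-Reasoning
      exchange : ∀ {P} → P i ≡ P k → count P x b ≡ count P x′ b
      exchange Pi≡Pk = count-exchange i≢k Pi≡Pk off on b
      both : P i ≡ P k → count P ⟦ u ⟧ b ≤ count P x′ b
      both Pi≡Pk = ≤-trans (dom P (lower-both Pi≡Pk lower) b) (≤-reflexive (exchange Pi≡Pk))
      by-cases : ∀ c d → P i ≡ c → P k ≡ d → count P ⟦ u ⟧ b ≤ count P x′ b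
      by-cases false false Pi Pk = both (trans Pi (sym Pk))
      by-cases true  true  Pi Pk = both (trans Pi (sym Pk))
      by-cases false true  Pi Pk = contradiction (trans (sym Pi) (lower i k κi<κk Pk)) λ ()
      -- If `x′ i` is below `b`, dropping row `i` costs `u` at most one and `x′` exactly one.
      -- Otherwise neither of the two labels is below `b`, and adding row `k` leaves the count of
      -- `x′` as it is.
      by-cases true  false Pi Pk with x′ i <? b
      ... | yes x′i<b = begin
        count P ⟦ u ⟧ b                      ≡⟨ count-insert i (≔-at P i false) Pi (λ m m≢i → sym (≔-off P false m≢i)) ⟦ u ⟧ b ⟩
        count P⁻ ⟦ u ⟧ b + 𝟙 (⟦ u ⟧ i <ᵇ b)  ≤⟨ +-mono-≤ (dom P⁻ (lower-remove Pi Pk lower) b) (𝟙≤1 (⟦ u ⟧ i <ᵇ b)) ⟩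
        count P⁻ x b + 1                     ≡⟨ cong₂ _+_ (exchange (trans (≔-at P i false) (sym (P⁻k Pi Pk lower)))) (sym (cong 𝟙 (<ᵇ-true x′i<b))) ⟩
        count P⁻ x′ b + 𝟙 (x′ i <ᵇ b)        ≡⟨ sym (count-insert i (≔-at P i false) Pi (λ m m≢i → sym (≔-off P false m≢i)) x′ b) ⟩
        count P x′ b                         ∎
        where P⁻ = P [ i ≔ false ]
      ... | no x′i≮b = begin
        count P ⟦ u ⟧ b                      ≤⟨ m≤m+n _ _ ⟩
        count P ⟦ u ⟧ b + 𝟙 (⟦ u ⟧ k <ᵇ b)   ≡⟨ sym (count-insert k Pk (≔-at P k true) (λ m → ≔-off P true) ⟦ u ⟧ b) ⟩
        count P⁺ ⟦ u ⟧ b                     ≤⟨ dom P⁺ (lower-insert Pi Pk lower) b ⟩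
        count P⁺ x b                         ≡⟨ exchange (trans (P⁺i Pi Pk lower) (sym (≔-at P k true))) ⟩
        count P⁺ x′ b                        ≡⟨ count-insert k Pk (≔-at P k true) (λ m → ≔-off P true) x′ b ⟩
        count P x′ b + 𝟙 (x′ k <ᵇ b)         ≡⟨ cong (λ c → count P x′ b + 𝟙 c) (<ᵇ-false (λ x′k<b → x′i≮b (<-trans asc x′k<b))) ⟩
        count P x′ b + 0                     ≡⟨ +-identityʳ _ ⟩
        count P x′ b                         ∎
        where P⁺ = P [ k ≔ true ]

  -- A filling to start from: free boxes are crosses until `constructible-free` overwrites them.
  some-box : ∀ i j → Σ Tile (Box i j)
  some-box i j with <-cmp (toℕ i) (toℕ (u ⟨$⟩ˡ j)) | <-cmp (⟦ u ⟧ i) (toℕ j)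
  ... | tri≈ _ i≡k _ | _ = pivot , pivot (Fin.toℕ-injective i≡k)
  ... | tri< i<k _ _ | tri≈ _ eq _ = contradiction (cong toℕ (column⁻¹ eq)) (<⇒≢ i<k)
  ... | tri> _ _ k<i | tri≈ _ eq _ = contradiction (cong toℕ (column⁻¹ eq)) (>⇒≢ k<i)
  ... | tri> _ _ k<i | tri< u<j _ _ = hor , hor k<i u<j
  ... | tri> _ _ k<i | tri> _ _ j<u = empty , empty k<i j<u
  ... | tri< i<k _ _ | tri> _ _ j<u = vert , vert i<k j<u
  ... | tri< i<k _ _ | tri< u<j _ _ = cross , cross i<k u<j

  module Replace (D : Tiling n) (box : ∀ i j → Box i j (D i j)) (i j : Fin n) (t : Tile) (bt : Box i j t) where

    D′ : Tiling n
    D′ a b with a Fin.≟ i | b Fin.≟ j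
    ... | yes _ | yes _ = t
    ... | _     | _     = D a b

    replaced : D′ i j ≡ t
    replaced with i Fin.≟ i | j Fin.≟ j
    ... | yes _  | yes _  = refl
    ... | no i≢i | _      = contradiction refl i≢i
    ... | yes _  | no j≢j = contradiction refl j≢j

    elsewhere : ∀ a b → ¬ (i ≡ a × j ≡ b) → D′ a b ≡ D a b
    elsewhere a b ≢ij with a Fin.≟ i | b Fin.≟ j
    ... | yes refl | yes refl = contradiction (refl , refl) ≢ij
    ... | yes _    | no _     = refl
    ... | no _     | _        = refl

    box′ : ∀ a b → Box a b (D′ a b)
    box′ a b with a Fin.≟ i | b Fin.≟ j
    ... | yes refl | yes refl = bt
    ... | yes _    | no _     = box a b
    ... | no _     | _        = box a b

    private
      P : ℕ → ℕ → Set
      P c d = ¬ Past i j c d → W D′ c d ≡ W D c d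

      step : ∀ (c d : Fin n) → P (toℕ c) (toℕ d) → P (toℕ c) (suc (toℕ d))
      step c d h ¬past = trans (W-step D′ c d) (trans (cong₂ (λ s w → act s c (u ⟨$⟩ˡ d) w) same (h before)) (sym (W-step D c d)))
        where
        before : ¬ Past i j (toℕ c) (toℕ d)
        before (inj₁ i<c) = ¬past (inj₁ i<c)
        before (inj₂ (i≡c , j<d)) = ¬past (inj₂ (i≡c , m<n⇒m<1+n j<d))
        same : D′ c d ≡ D c d
        same = elsewhere c d λ { (refl , refl) → ¬past (inj₂ (refl , n<1+n _)) }

      next : ∀ (c : Fin n) → P (toℕ c) n → P (suc (toℕ c)) 0
      next c h ¬past = h λ { (inj₁ i<c) → ¬past (inj₁ (m<n⇒m<1+n i<c)) ; (inj₂ (i≡c , _)) → ¬past (inj₁ (s≤s (≤-reflexive i≡c))) }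

    unchanged : ∀ c d → ¬ Past i j (toℕ c) (toℕ d) → W D′ (toℕ c) (toℕ d) ≡ W D (toℕ c) (toℕ d)
    unchanged c d = sweep-box P (λ _ → refl) step next c (<⇒≤ (Fin.toℕ<n d))

  Past-asym : ∀ {i j c d : Fin n} → Past i j (toℕ c) (toℕ d) → ¬ Past c d (toℕ i) (toℕ j)
  Past-asym (inj₁ i<c) (inj₁ c<i) = <-asym i<c c<i
  Past-asym (inj₁ i<c) (inj₂ (c≡i , _)) = <⇒≢ i<c (sym c≡i)
  Past-asym (inj₂ (i≡c , _)) (inj₁ c<i) = <⇒≢ c<i (sym i≡c)
  Past-asym (inj₂ (_ , j<d)) (inj₂ (_ , d<j)) = <-asym j<d d<j

  Realized : ℕ → ℕ → Permutation′ n → Set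
  Realized i j x = Σ (Tiling n) λ D → (∀ a b → Box a b (D a b)) ×
    (∀ m → W D i j ⟨$⟩ʳ m ≡ x ⟨$⟩ʳ m) × (∀ a b → Past a b i j → Ascending D a b)

  -- Quantified over all `x` because the target changes on the way back: a tiling for `x` after a
  -- box comes from one for the sorted `x′` before it. The backward reading thus becomes a forward
  -- induction on the position.
  Constructible : ℕ → ℕ → Set
  Constructible i j = ∀ x → Dominates (key i j) ⟦ x ⟧ ⟦ u ⟧ → Realized i j x

  constructible-start : Constructible 0 0
  constructible-start x dom = (λ i j → proj₁ (some-box i j)) , (λ i j → proj₂ (some-box i j)) ,
    start-unique x dom , λ { a b (inj₁ ()) ; a b (inj₂ (_ , ())) }

  constructible-next : ∀ (i : Fin n) → Constructible (toℕ i) n → Constructible (suc (toℕ i)) 0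
  constructible-next i c x dom with c x (Dominates-order (next-row i) dom)
  ... | D , box , e , asc = D , box , e , λ a b past → asc a b (Past-next past)

  constructible-still : ∀ i j → toℕ (u ⟨$⟩ˡ j) ≤ toℕ i ⊎ toℕ j < ⟦ u ⟧ i →
                        Constructible (toℕ i) (toℕ j) → Constructible (toℕ i) (suc (toℕ j))
  constructible-still i j h c x dom with c x (Dominates-order (still i j h) dom)
  ... | D , box , e , asc = D , box , (λ m → trans (cong (_⟨$⟩ʳ m) same) (e m)) , λ a b past → by-past a b (Past-step i j past)
    where
    not-free : i <ᶠ (u ⟨$⟩ˡ j) → ¬ (⟦ u ⟧ i < toℕ j)
    not-free i<k u<j = [ <⇒≱ i<k , <-asym u<j ] h
    same : W D (toℕ i) (suc (toℕ j)) ≡ W D (toℕ i) (toℕ j)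
    same = trans (W-step D i j) (by-kind (kind (box i j)))
      where
      by-kind : Kind i j (D i j) → act (D i j) i (u ⟨$⟩ˡ j) (W D (toℕ i) (toℕ j)) ≡ W D (toℕ i) (toℕ j)
      by-kind (plain _ e _) = e _
      by-kind (cross _ i<k u<j) = contradiction u<j (not-free i<k)
      by-kind (elbow _ i<k u<j) = contradiction u<j (not-free i<k)
    by-past : ∀ a b → Past a b (toℕ i) (toℕ j) ⊎ (a ≡ i × b ≡ j) → Ascending D a b
    by-past a b (inj₁ past) = asc a b past
    by-past a b (inj₂ (refl , refl)) i<k u<j = contradiction u<j (not-free i<k)

  constructible-free : ∀ i j → i <ᶠ (u ⟨$⟩ˡ j) → ⟦ u ⟧ i < toℕ j →
                       Constructible (toℕ i) (toℕ j) → Constructible (toℕ i) (suc (toℕ j))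
  constructible-free i j i<k u<j c x dom = by-order (<-cmp (⟦ x ⟧ i) (⟦ x ⟧ k))
    where
    k = u ⟨$⟩ˡ j
    open Crossing i j i<k u<j using (i≢k)
    extend : ∀ t → Box i j t → (x′ : Permutation′ n) → (∀ w → (∀ m → w ⟨$⟩ʳ m ≡ x′ ⟨$⟩ʳ m) → ∀ m → act t i k w ⟨$⟩ʳ m ≡ x ⟨$⟩ʳ m) →
             ⟦ x′ ⟧ i < ⟦ x′ ⟧ k → Dominates (key (toℕ i) (toℕ j)) ⟦ x′ ⟧ ⟦ u ⟧ → Realized (toℕ i) (suc (toℕ j)) x
    extend t bt x′ h lt dom′ with c x′ dom′
    ... | D , box , e , asc = D′ , box′ , end , λ a b past → by-past a b (Past-step i j past)
      where
      open Replace D box i j t bt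
      now : W D′ (toℕ i) (toℕ j) ≡ W D (toℕ i) (toℕ j)
      now = unchanged i j λ { (inj₁ i<i) → <-irrefl refl i<i ; (inj₂ (_ , j<j)) → <-irrefl refl j<j }
      e′ : ∀ m → W D′ (toℕ i) (toℕ j) ⟨$⟩ʳ m ≡ x′ ⟨$⟩ʳ m
      e′ m = trans (cong (_⟨$⟩ʳ m) now) (e m)
      end : ∀ m → W D′ (toℕ i) (suc (toℕ j)) ⟨$⟩ʳ m ≡ x ⟨$⟩ʳ m
      end m = trans (cong (_⟨$⟩ʳ m) (trans (W-step D′ i j) (cong (λ s → act s i k (W D′ (toℕ i) (toℕ j))) replaced))) (h (W D′ (toℕ i) (toℕ j)) e′ m)
      by-past : ∀ a b → Past a b (toℕ i) (toℕ j) ⊎ (a ≡ i × b ≡ j) → Ascending D′ a b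
      by-past a b (inj₁ past) rewrite unchanged a b (Past-asym past) = asc a b past
      by-past a b (inj₂ (refl , refl)) _ _ = subst₂ _<ᶠ_ (sym (e′ i)) (sym (e′ k)) lt
    by-order : Tri (⟦ x ⟧ i < ⟦ x ⟧ k) (⟦ x ⟧ i ≡ ⟦ x ⟧ k) (⟦ x ⟧ k < ⟦ x ⟧ i) → Realized (toℕ i) (suc (toℕ j)) x
    -- After the box row `k` precedes row `i` on the frontier, so here the labels are out of order,
    -- and a cross leaves `x` as it is. In the opposite case an elbow swaps them, and the
    -- permutation before it is the transposed one.
    by-order (tri< lt _ _) = extend cross (cross i<k u<j) x (λ w h → h) lt
      (Dominates-sort i j i<k u<j (λ _ _ _ → refl) (inj₁ (refl , refl)) lt dom)
    by-order (tri≈ _ eq _) = contradiction (⟦⟧-injective x eq) i≢k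
    by-order (tri> _ _ gt) = extend elbow (elbow i<k u<j) (transpose i k ∘ₚ x)
      (λ w h m → trans (h (transpose i k ⟨$⟩ʳ m)) (cong (x ⟨$⟩ʳ_) (transpose-involutive i k m))) lt
      (Dominates-sort i j i<k u<j (λ m m≢i m≢k → cong ⟦ x ⟧ (transpose-other m≢i m≢k)) (inj₂ (x′i , x′k)) lt dom)
      where
      x′i : ⟦ transpose i k ∘ₚ x ⟧ i ≡ ⟦ x ⟧ k
      x′i = cong ⟦ x ⟧ (transpose-left i k)
      x′k : ⟦ transpose i k ∘ₚ x ⟧ k ≡ ⟦ x ⟧ i
      x′k = cong ⟦ x ⟧ (transpose-right i k)
      lt : ⟦ transpose i k ∘ₚ x ⟧ i < ⟦ transpose i k ∘ₚ x ⟧ k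
      lt = subst₂ _<_ (sym x′i) (sym x′k) gt

  constructible-step : ∀ i j → Constructible (toℕ i) (toℕ j) → Constructible (toℕ i) (suc (toℕ j))
  constructible-step i j with toℕ (u ⟨$⟩ˡ j) ≤? toℕ i | ⟦ u ⟧ i <? toℕ j
  ... | yes k≤i | _       = constructible-still i j (inj₁ k≤i)
  ... | no k≰i  | yes u<j = constructible-free i j (≰⇒> k≰i) u<j
  ... | no k≰i  | no u≮j  = constructible-still i j (inj₂ (≤∧≢⇒< (≮⇒≥ u≮j) λ j≡u → k≰i (≤-reflexive (cong toℕ (sym (column⁻¹ (sym j≡u)))))))

  ≤B⇒IsFPP : {v : Permutation′ n} → u ≤B v → Σ (Tiling n) (IsFPP u v)
  ≤B⇒IsFPP {v} u≤v
    with sweep-start Constructible constructible-start constructible-step constructible-next ≤-refl v (≤B⇒Dominates u≤v)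
  ... | D , box , e , asc = D , ascending⇒IsFPP D box (λ i j → asc i j (inj₁ (Fin.toℕ<n i))) {v} e

theorem3p16 : (n : ℕ) (u v : Permutation′ n) →
    ((Σ (Tiling n) λ D → IsFPP u v D) ⇔ (u ≤B v)) ×
    (∀ (D : Tiling n) → IsFPP u v D → ℓ v ≡ ℓ u + elbowCount D)
theorem3p16 n u v = mk⇔ (λ (D , fpp) → IsFPP⇒≤B D fpp) ≤B⇒IsFPP , IsFPP⇒length
  where
  open Rothe u
  module _ (D : Tiling n) (fpp : IsFPP u v D) where
    private
      rothe   = proj₁ fpp
      reduced = proj₁ (proj₂ (proj₂ fpp))
      exits   = proj₁ (proj₂ (proj₂ (proj₂ fpp)))
      noTouch = proj₂ (proj₂ (proj₂ (proj₂ fpp)))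
      box = IsRothe⇒Box rothe
      ascending = IsFPP⇒ascending D box reduced noTouch
      exit-v = exit-permutation D box {v} exits
    IsFPP⇒≤B : u ≤B v
    IsFPP⇒≤B = ≤B-respʳ (ascending⇒≤B D box ascending) exit-v
    IsFPP⇒length : ℓ v ≡ ℓ u + elbowCount D
    IsFPP⇒length = trans (sym (ℓ-cong {u = W D n 0} {v} exit-v)) (ascending⇒length D box ascending)
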